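{- There exist absolute constants $C,D>0$ such that the following holds. Let $n=2^\ell$, let $S\subseteq\mathbb F_2^u$ have size $m$, and let $\lambda:=m/n$. Let $h:\mathbb F_2^u\to\mathbb F_2^\ell$ be a uniformly random linear map. Then for every real $T>0$ satisfying $T\ge D\lambda n^{1/T}$, \[ \Pr_h[\mathsf M(S,h)\ge T]\le C\left(\frac{\lambda n^{1/T}}{T}\right)^2. \]
   Context: For a linear map $h:\mathbb F_2^u\to\mathbb F_2^\ell$ and $S\subseteq\mathbb F_2^u$, $\mathsf M(S,h):=\max_{y\in\mathbb F_2^\ell}|h^{ -1}(y)\cap S|$. A uniformly random linear map is chosen uniformly among all $\mathbb F_2$-linear maps $\mathbb F_2^u\to\mathbb F_2^\ell$.
   Formalization: The threshold T ranges over positive rationals p/q instead of positive reals, with the inequalities involving n^{1/T} stated after raising both sides to the p-th power; the constants C, D are rational. -}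

module Defs where

open import Data.Bool using (Bool; true; false; _∧_; _xor_)
open import Data.Bool.Properties using () renaming (_≟_ to _≟B_)
open import Data.Nat as ℕ using (ℕ; zero; suc; _⊔_; _^_; NonZero)
open import Data.Nat.Properties using (m^n≢0)
open import Data.Integer using (+_)
open import Data.List using (List; []; _∷_; length; filter; map; foldr; concatMap)
open import Data.Vec using (Vec; []; _∷_; zipWith)
open import Data.Vec.Properties using (≡-dec)
open import Data.Rational as ℚ using (ℚ; _/_; _≤?_) renaming (_*_ to _*ℚ_)
open import Relation.Nullary.Decidable using (Dec)
open import Relation.Binary.PropositionalEquality using (_≡_)

-- The field F₂ is modelled by Bool (false = 0, true = 1, xor = +, ∧ = ·).
-- A vector of F₂^u is a Vec Bool u.
F₂^ : ℕ → Set
F₂^ u = Vec Bool u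

_≟V_ : ∀ {u} (x y : F₂^ u) → Dec (x ≡ y)
_≟V_ = ≡-dec _≟B_

allVecsOf : ∀ {a} {A : Set a} → List A → (n : ℕ) → List (Vec A n)
allVecsOf xs zero    = [] ∷ []
allVecsOf xs (suc n) = concatMap (λ x → map (x ∷_) (allVecsOf xs n)) xs

allF₂^ : (n : ℕ) → List (F₂^ n)
allF₂^ n = allVecsOf (false ∷ true ∷ []) n

-- F₂-linear maps F₂^u → F₂^ℓ are represented (bijectively) by their
-- ℓ × u matrices over F₂ (a list of ℓ rows, each in F₂^u).
LinMap : ℕ → ℕ → Set
LinMap u ℓ = Vec (F₂^ u) ℓ

dot : ∀ {u} → F₂^ u → F₂^ u → Bool
dot []       []       = false
dot (a ∷ as) (b ∷ bs) = (a ∧ b) xor dot as bs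

apply : ∀ {u ℓ} → LinMap u ℓ → F₂^ u → F₂^ ℓ
apply []         x = []
apply (r ∷ rows) x = dot r x ∷ apply rows x

allLinMaps : (u ℓ : ℕ) → List (LinMap u ℓ)
allLinMaps u ℓ = allVecsOf (allF₂^ u) ℓ

-- M(S,h) = max_y |h⁻¹(y) ∩ S|, where S is given as a duplicate-free list
fiberSize : ∀ {u ℓ} → List (F₂^ u) → LinMap u ℓ → F₂^ ℓ → ℕ
fiberSize S h y = length (filter (λ x → apply h x ≟V y) S)

M : ∀ {u ℓ} → List (F₂^ u) → LinMap u ℓ → ℕ
M {u} {ℓ} S h = foldr _⊔_ 0 (map (fiberSize S h) (allF₂^ ℓ))

ℕ→ℚ : ℕ → ℚ
ℕ→ℚ k = (+ k) / 1

PrMge : (u ℓ : ℕ) → List (F₂^ u) → ℚ → ℚ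
PrMge u ℓ S T =
  _/_ (+ length (filter (λ h → T ≤? ℕ→ℚ (M S h)) (allLinMaps u ℓ)))
      (2 ^ (ℓ ℕ.* u)) {{m^n≢0 2 (ℓ ℕ.* u)}}

_^ℚ_ : ℚ → ℕ → ℚ
q ^ℚ zero  = ℚ.1ℚ
q ^ℚ suc k = q *ℚ (q ^ℚ k)

{-# OPTIONS --safe #-}

-- Place S inside the slice {0} × F₂^u of F₂^ℓ × F₂^u and map this space to F₂^ℓ by quotienting
-- out, one coordinate of F₂^u at a time, a vector (v , 1 , w) with v, w uniform.  The resulting
-- map is (y , x) ↦ y + h x with h uniform, so a uniform linear map is revealed in u steps.
--
-- Let f be the current fiber count and 1 + ε the mean of a^f.  A step replaces ε by 2ε + X with
-- X ≥ 0 and E[X] ≤ ε² (each quotient pairs the two halves of the space, whence AM-GM).  Since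
-- min((2ε + X)², B²) ≤ 4ε² + 2BX when 2ε ≤ B, and 4ε² + 2Bε² ≤ ε² B² / A² for B = 2A(1 + A),
-- induction gives Pr[ε_u ≥ A_u] ≤ (ε_0 / A_0)² as soon as 1 + 2A_u = (1 + 2A_0)^(2^u).
--
-- With τ = ⌈T⌉ and A_0 = τ / (4·2^u) one has 1 + 2A_u ≤ 2^τ, while a load of τ forces
-- 1 + ε_u ≥ a^τ / n.  So a = 2^(1+t) with 2^t ≥ n^(1/T) works, and t can be chosen with
-- 2^t ≤ 2 n^(1/T); finally ε_0 ≤ m a / 2^(ℓ+u).
module Submission where

open import Defs
open import Data.Nat as ℕ using (ℕ; _^_; NonZero)
open import Data.Nat.Properties using (m^n≢0)
open import Data.Integer using (+_)
open import Data.List using (List; length)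
open import Data.List.Relation.Unary.Unique.Propositional using (Unique)
open import Data.Rational using (ℚ; _/_; _*_; _≤_; _<_; 0ℚ)
open import Data.Product using (Σ; _×_)
open import Data.Bool using (Bool; true; false; _∧_; _xor_)
open import Data.Bool.Properties
  using (xor-assoc; xor-comm; xor-same; xor-identityʳ; ∧-distribˡ-xor; xor-∧-commutativeRing)
open import Data.Empty using (⊥-elim)
open import Data.List using ([]; _∷_; _++_; map; concatMap; filter; foldr)
open import Data.List.Relation.Unary.All using (All; []; _∷_)
open import Data.List.Relation.Unary.AllPairs using ([]; _∷_)
open import Data.List.Relation.Unary.Any using (here; there)
open import Data.List.Membership.Propositional using (_∈_)
open import Data.Nat using (zero; suc; pred; _⊔_; z≤n; s≤s)
import Data.Nat.Properties as ℕₚ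
open import Data.Nat.DivMod using (m≡m%n+[m/n]*n; m%n≤n; m%n<n; m/n*n≤m; m<n*o⇒m/o<n)
open import Data.Nat.Tactic.RingSolver using (solve-∀)
import Data.Integer as ℤ
import Data.Integer.Properties as ℤₚ
import Data.Rational as ℚ
import Data.Rational.Properties as ℚₚ
import Data.Rational.Unnormalised as ℚᵘ
import Data.Rational.Unnormalised.Properties as ℚᵘₚ
open import Data.Product using (_,_; ∃)
open import Data.Sum using (inj₁; inj₂)
open import Data.Vec using (Vec; []; _∷_; zipWith; replicate)
open import Data.Vec.Properties using (zipWith-assoc; zipWith-comm; zipWith-identityʳ; ∷-injectiveʳ)
open import Algebra.Bundles using (CommutativeMonoid; CommutativeRing)
open import Algebra.Properties.CommutativeSemigroup
  (CommutativeMonoid.commutativeSemigroup (CommutativeRing.+-commutativeMonoid xor-∧-commutativeRing))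
  using (interchange)
open import Function using (_∘_)
open import Level using (Level)
open import Relation.Binary.PropositionalEquality
  using (_≡_; _≢_; refl; sym; trans; cong; cong₂; subst; subst₂; module ≡-Reasoning)
open import Relation.Nullary using (Dec; yes; no; ¬_)
open import Relation.Unary using (Pred; Decidable)

private
  variable
    ℓᵃ ℓᵇ ℓᵖ : Level
    A : Set ℓᵃ
    B : Set ℓᵇ

-- Finite sums over lists

∑ : List A → (A → ℕ) → ℕ
∑ []       f = 0
∑ (x ∷ xs) f = f x ℕ.+ ∑ xs f

syntax ∑ xs (λ x → e) = ∑[ x ∈ xs ] e

∑-cong : ∀ (xs : List A) {f g : A → ℕ} → (∀ x → f x ≡ g x) → ∑ xs f ≡ ∑ xs g
∑-cong []       f≗g = refl
∑-cong (x ∷ xs) f≗g = cong₂ ℕ._+_ (f≗g x) (∑-cong xs f≗g)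

∑-mono : ∀ (xs : List A) {f g : A → ℕ} → (∀ x → f x ℕ.≤ g x) → ∑ xs f ℕ.≤ ∑ xs g
∑-mono []       f≤g = z≤n
∑-mono (x ∷ xs) f≤g = ℕₚ.+-mono-≤ (f≤g x) (∑-mono xs f≤g)

∑-zero : ∀ (xs : List A) → ∑[ _ ∈ xs ] 0 ≡ 0
∑-zero []       = refl
∑-zero (x ∷ xs) = ∑-zero xs

∑-const : ∀ (xs : List A) k → ∑[ _ ∈ xs ] k ≡ length xs ℕ.* k
∑-const []       k = refl
∑-const (x ∷ xs) k = cong (k ℕ.+_) (∑-const xs k)

∑-+ : ∀ (xs : List A) (f g : A → ℕ) → ∑[ x ∈ xs ] (f x ℕ.+ g x) ≡ ∑ xs f ℕ.+ ∑ xs g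
∑-+ []       f g = refl
∑-+ (x ∷ xs) f g = trans (cong ((f x ℕ.+ g x) ℕ.+_) (∑-+ xs f g))
                         (rearrange (f x) (g x) (∑ xs f) (∑ xs g))
  where
  rearrange : ∀ a b c d → (a ℕ.+ b) ℕ.+ (c ℕ.+ d) ≡ (a ℕ.+ c) ℕ.+ (b ℕ.+ d)
  rearrange = solve-∀

∑-*ˡ : ∀ (xs : List A) k (f : A → ℕ) → ∑[ x ∈ xs ] (k ℕ.* f x) ≡ k ℕ.* ∑ xs f
∑-*ˡ []       k f = sym (ℕₚ.*-zeroʳ k)
∑-*ˡ (x ∷ xs) k f = trans (cong (k ℕ.* f x ℕ.+_) (∑-*ˡ xs k f))
                          (sym (ℕₚ.*-distribˡ-+ k (f x) (∑ xs f)))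

∑-*ʳ : ∀ (xs : List A) k (f : A → ℕ) → ∑[ x ∈ xs ] (f x ℕ.* k) ≡ ∑ xs f ℕ.* k
∑-*ʳ xs k f = trans (∑-cong xs λ x → ℕₚ.*-comm (f x) k)
             (trans (∑-*ˡ xs k f) (ℕₚ.*-comm k _))

∑-swap : ∀ (xs : List A) (ys : List B) (f : A → B → ℕ) →
         ∑[ x ∈ xs ] ∑[ y ∈ ys ] f x y ≡ ∑[ y ∈ ys ] ∑[ x ∈ xs ] f x y
∑-swap []       ys f = sym (∑-zero ys)
∑-swap (x ∷ xs) ys f = trans (cong (∑ ys (f x) ℕ.+_) (∑-swap xs ys f))
                             (sym (∑-+ ys (f x) λ y → ∑[ z ∈ xs ] f z y))

∑-++ : ∀ (xs ys : List A) (f : A → ℕ) → ∑ (xs ++ ys) f ≡ ∑ xs f ℕ.+ ∑ ys f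
∑-++ []       ys f = refl
∑-++ (x ∷ xs) ys f = trans (cong (f x ℕ.+_) (∑-++ xs ys f)) (sym (ℕₚ.+-assoc (f x) _ _))

∑-map : ∀ (h : A → B) (xs : List A) (f : B → ℕ) → ∑ (map h xs) f ≡ ∑ xs (f ∘ h)
∑-map h []       f = refl
∑-map h (x ∷ xs) f = cong (f (h x) ℕ.+_) (∑-map h xs f)

∑-concatMap : ∀ (h : A → List B) (xs : List A) (f : B → ℕ) →
              ∑ (concatMap h xs) f ≡ ∑[ x ∈ xs ] ∑ (h x) f
∑-concatMap h []       f = refl
∑-concatMap h (x ∷ xs) f = trans (∑-++ (h x) (concatMap h xs) f)
                                 (cong (∑ (h x) f ℕ.+_) (∑-concatMap h xs f))

∑-∈-≤ : ∀ {xs : List A} {x} (f : A → ℕ) → x ∈ xs → f x ℕ.≤ ∑ xs f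
∑-∈-≤ f (here refl) = ℕₚ.m≤m+n _ _
∑-∈-≤ f (there x∈)  = ℕₚ.m≤n⇒m≤o+n _ (∑-∈-≤ f x∈)

∑-allVecsOf-suc : ∀ (xs : List A) n (f : Vec A (suc n) → ℕ) →
                  ∑ (allVecsOf xs (suc n)) f ≡ ∑[ x ∈ xs ] ∑[ v ∈ allVecsOf xs n ] f (x ∷ v)
∑-allVecsOf-suc xs n f = trans (∑-concatMap _ xs f) (∑-cong xs λ x → ∑-map (x ∷_) (allVecsOf xs n) f)

∑-F₂^-suc : ∀ n (f : F₂^ (suc n) → ℕ) →
            ∑ (allF₂^ (suc n)) f ≡ ∑ (allF₂^ n) (f ∘ (false ∷_)) ℕ.+ ∑ (allF₂^ n) (f ∘ (true ∷_))
∑-F₂^-suc n f = trans (∑-allVecsOf-suc (false ∷ true ∷ []) n f)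
                      (cong (∑ (allF₂^ n) (f ∘ (false ∷_)) ℕ.+_) (ℕₚ.+-identityʳ _))

∑-F₂^-const : ∀ n k → ∑[ _ ∈ allF₂^ n ] k ≡ 2 ^ n ℕ.* k
∑-F₂^-const zero    k = refl
∑-F₂^-const (suc n) k = begin
  ∑[ _ ∈ allF₂^ (suc n) ] k             ≡⟨ ∑-F₂^-suc n _ ⟩
  ∑[ _ ∈ allF₂^ n ] k ℕ.+ ∑[ _ ∈ allF₂^ n ] k ≡⟨ cong (λ z → z ℕ.+ z) (∑-F₂^-const n k) ⟩
  2 ^ n ℕ.* k ℕ.+ 2 ^ n ℕ.* k           ≡⟨ double (2 ^ n) k ⟩
  2 ^ suc n ℕ.* k                       ∎
  where
  open ≡-Reasoning
  double : ∀ a b → a ℕ.* b ℕ.+ a ℕ.* b ≡ (2 ℕ.* a) ℕ.* b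
  double = solve-∀

-- Indicators

⟦_⟧ : {P : Set ℓᵖ} → Dec P → ℕ
⟦ yes _ ⟧ = 1
⟦ no  _ ⟧ = 0

⟦⟧≤1 : {P : Set ℓᵖ} (d : Dec P) → ⟦ d ⟧ ℕ.≤ 1
⟦⟧≤1 (yes _) = ℕₚ.≤-refl
⟦⟧≤1 (no  _) = z≤n

⟦⟧-mono : ∀ {ℓᵠ} {P : Set ℓᵖ} {Q : Set ℓᵠ} (d : Dec P) (d′ : Dec Q) → (P → Q) → ⟦ d ⟧ ℕ.≤ ⟦ d′ ⟧
⟦⟧-mono (no _)  _        _   = z≤n
⟦⟧-mono (yes _) (yes _)  _   = ℕₚ.≤-refl
⟦⟧-mono (yes p) (no ¬q)  p⇒q = ⊥-elim (¬q (p⇒q p))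

⟦⟧-false : {P : Set ℓᵖ} (d : Dec P) → ¬ P → ⟦ d ⟧ ≡ 0
⟦⟧-false (yes p) ¬p = ⊥-elim (¬p p)
⟦⟧-false (no _)  ¬p = refl

length-filter≡∑ : {P : Pred A ℓᵖ} (P? : Decidable P) (xs : List A) →
                  length (filter P? xs) ≡ ∑[ x ∈ xs ] ⟦ P? x ⟧
length-filter≡∑ P? []       = refl
length-filter≡∑ P? (x ∷ xs) with P? x
... | yes _ = cong suc (length-filter≡∑ P? xs)
... | no  _ = length-filter≡∑ P? xs

∑-δ : ∀ {n} (s : F₂^ n) (g : F₂^ n → ℕ) → ∑[ x ∈ allF₂^ n ] (⟦ s ≟V x ⟧ ℕ.* g x) ≡ g s
∑-δ {zero}  []      g = trans (ℕₚ.+-identityʳ _) (ℕₚ.*-identityˡ _)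
∑-δ {suc n} (b ∷ s) g = trans (∑-F₂^-suc n _) (split b)
  where
  here≡ : ∀ b → ∑[ x ∈ allF₂^ n ] (⟦ (b ∷ s) ≟V (b ∷ x) ⟧ ℕ.* g (b ∷ x)) ≡ g (b ∷ s)
  here≡ b = trans (∑-cong (allF₂^ n) λ x → cong (ℕ._* g (b ∷ x)) (ℕₚ.≤-antisym
                     (⟦⟧-mono ((b ∷ s) ≟V (b ∷ x)) (s ≟V x) ∷-injectiveʳ)
                     (⟦⟧-mono (s ≟V x) ((b ∷ s) ≟V (b ∷ x)) (cong (b ∷_)))))
                  (∑-δ s (g ∘ (b ∷_)))
  there≡ : ∀ b b′ → b ≢ b′ → ∑[ x ∈ allF₂^ n ] (⟦ (b ∷ s) ≟V (b′ ∷ x) ⟧ ℕ.* g (b′ ∷ x)) ≡ 0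
  there≡ b b′ b≢b′ = trans (∑-cong (allF₂^ n) λ x → cong (ℕ._* g (b′ ∷ x))
                             (⟦⟧-false ((b ∷ s) ≟V (b′ ∷ x)) λ { refl → b≢b′ refl }))
                           (∑-zero (allF₂^ n))
  split : ∀ b → ∑[ x ∈ allF₂^ n ] (⟦ (b ∷ s) ≟V (false ∷ x) ⟧ ℕ.* g (false ∷ x))
            ℕ.+ ∑[ x ∈ allF₂^ n ] (⟦ (b ∷ s) ≟V (true ∷ x) ⟧ ℕ.* g (true ∷ x)) ≡ g (b ∷ s)
  split false = trans (cong₂ ℕ._+_ (here≡ false) (there≡ false true λ ())) (ℕₚ.+-identityʳ _)
  split true  = cong₂ ℕ._+_ (there≡ true false λ ()) (here≡ true)

-- Linear algebra over F₂

_⊕_ : ∀ {n} → F₂^ n → F₂^ n → F₂^ n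
_⊕_ = zipWith _xor_

infixl 6 _⊕_

𝟎 : ∀ {n} → F₂^ n
𝟎 = replicate _ false

⊕-assoc : ∀ {n} (x y z : F₂^ n) → (x ⊕ y) ⊕ z ≡ x ⊕ (y ⊕ z)
⊕-assoc = zipWith-assoc xor-assoc

⊕-comm : ∀ {n} (x y : F₂^ n) → x ⊕ y ≡ y ⊕ x
⊕-comm = zipWith-comm xor-comm

⊕-identityʳ : ∀ {n} (x : F₂^ n) → x ⊕ 𝟎 ≡ x
⊕-identityʳ = zipWith-identityʳ xor-identityʳ

⊕-self : ∀ {n} (x : F₂^ n) → x ⊕ x ≡ 𝟎
⊕-self []      = refl
⊕-self (b ∷ x) = cong₂ _∷_ (xor-same b) (⊕-self x)

-- Translation permutes the space; a leading `true` merely exchanges the two halves of the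
-- enumeration. Later changes of variable by a uniform vector all rest on this.
∑-translate : ∀ {n} (v : F₂^ n) (f : F₂^ n → ℕ) → ∑[ x ∈ allF₂^ n ] f (v ⊕ x) ≡ ∑ (allF₂^ n) f
∑-translate {zero}  []      f = refl
∑-translate {suc n} (b ∷ v) f =
  trans (∑-F₂^-suc n (λ x → f ((b ∷ v) ⊕ x))) (trans (halves b) (sym (∑-F₂^-suc n f)))
  where
  halves : ∀ b → ∑[ x ∈ allF₂^ n ] f ((b ∷ v) ⊕ (false ∷ x)) ℕ.+ ∑[ x ∈ allF₂^ n ] f ((b ∷ v) ⊕ (true ∷ x))
         ≡ ∑ (allF₂^ n) (f ∘ (false ∷_)) ℕ.+ ∑ (allF₂^ n) (f ∘ (true ∷_))
  halves false = cong₂ ℕ._+_ (∑-translate v _) (∑-translate v _)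
  halves true  = trans (cong₂ ℕ._+_ (∑-translate v _) (∑-translate v _)) (ℕₚ.+-comm _ (∑ (allF₂^ n) (f ∘ (false ∷_))))

∑-translateʳ : ∀ {n} (v : F₂^ n) (f : F₂^ n → ℕ) → ∑[ x ∈ allF₂^ n ] f (x ⊕ v) ≡ ∑ (allF₂^ n) f
∑-translateʳ v f = trans (∑-cong (allF₂^ _) λ x → cong f (⊕-comm x v)) (∑-translate v f)

dot-⊕ : ∀ {n} (r x y : F₂^ n) → dot r (x ⊕ y) ≡ dot r x xor dot r y
dot-⊕ []      []      []      = refl
dot-⊕ (a ∷ r) (b ∷ x) (c ∷ y) =
  trans (cong₂ _xor_ (∧-distribˡ-xor a b c) (dot-⊕ r x y))
        (interchange (a ∧ b) (a ∧ c) (dot r x) (dot r y))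

apply-⊕ : ∀ {u ℓ} (h : LinMap u ℓ) (x y : F₂^ u) → apply h (x ⊕ y) ≡ apply h x ⊕ apply h y
apply-⊕ []      x y = refl
apply-⊕ (r ∷ h) x y = cong₂ _∷_ (dot-⊕ r x y) (apply-⊕ h x y)

-- Matrices are stored by rows, so a new input coordinate is a new first column, inserted one entry
-- per row.
_∣∷_ : ∀ {u ℓ} → F₂^ ℓ → LinMap u ℓ → LinMap (suc u) ℓ
_∣∷_ = zipWith _∷_

apply-∣∷-false : ∀ {u ℓ} (c : F₂^ ℓ) (h : LinMap u ℓ) x → apply (c ∣∷ h) (false ∷ x) ≡ apply h x
apply-∣∷-false []          []      x = refl
apply-∣∷-false (false ∷ c) (r ∷ h) x = cong (dot r x ∷_) (apply-∣∷-false c h x)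
apply-∣∷-false (true ∷ c)  (r ∷ h) x = cong (dot r x ∷_) (apply-∣∷-false c h x)

apply-∣∷-true : ∀ {u ℓ} (c : F₂^ ℓ) (h : LinMap u ℓ) x → apply (c ∣∷ h) (true ∷ x) ≡ c ⊕ apply h x
apply-∣∷-true []          []      x = refl
apply-∣∷-true (false ∷ c) (r ∷ h) x = cong (dot r x ∷_) (apply-∣∷-true c h x)
apply-∣∷-true (true ∷ c)  (r ∷ h) x = cong (_ ∷_) (apply-∣∷-true c h x)

∑-LinMap-zero : ∀ ℓ (f : LinMap 0 ℓ → ℕ) → ∑ (allLinMaps 0 ℓ) f ≡ f (replicate ℓ [])
∑-LinMap-zero zero    f = ℕₚ.+-identityʳ _
∑-LinMap-zero (suc ℓ) f = trans (∑-allVecsOf-suc ([] ∷ []) ℓ f)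
                         (trans (ℕₚ.+-identityʳ _) (∑-LinMap-zero ℓ (f ∘ ([] ∷_))))

-- Maps are enumerated row by row, whereas the process reveals them column by column. Splitting off
-- the first bit of each row and exchanging sums reconciles the two.
∑-LinMap-suc : ∀ u ℓ (f : LinMap (suc u) ℓ → ℕ) →
               ∑ (allLinMaps (suc u) ℓ) f ≡ ∑[ c ∈ allF₂^ ℓ ] ∑[ h ∈ allLinMaps u ℓ ] f (c ∣∷ h)
∑-LinMap-suc u zero    f = sym (ℕₚ.+-identityʳ _)
∑-LinMap-suc u (suc ℓ) f = begin
  ∑ (allLinMaps (suc u) (suc ℓ)) f
    ≡⟨ ∑-allVecsOf-suc (allF₂^ (suc u)) ℓ f ⟩
  ∑[ r ∈ allF₂^ (suc u) ] ∑[ h ∈ allLinMaps (suc u) ℓ ] f (r ∷ h)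
    ≡⟨ ∑-F₂^-suc u _ ⟩
  rows false ℕ.+ rows true
    ≡⟨ cong₂ ℕ._+_ (half false) (half true) ⟩
  cols false ℕ.+ cols true
    ≡⟨ ∑-F₂^-suc ℓ (λ c → ∑[ h ∈ allLinMaps u (suc ℓ) ] f (c ∣∷ h)) ⟨
  ∑[ c ∈ allF₂^ (suc ℓ) ] ∑[ h ∈ allLinMaps u (suc ℓ) ] f (c ∣∷ h) ∎
  where
  open ≡-Reasoning
  rows cols : Bool → ℕ
  rows b = ∑[ r ∈ allF₂^ u ] ∑[ h ∈ allLinMaps (suc u) ℓ ] f ((b ∷ r) ∷ h)
  cols b = ∑[ c ∈ allF₂^ ℓ ] ∑[ h ∈ allLinMaps u (suc ℓ) ] f ((b ∷ c) ∣∷ h)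
  half : ∀ b → rows b ≡ cols b
  half b = begin
    rows b
      ≡⟨ ∑-cong (allF₂^ u) (λ r → ∑-LinMap-suc u ℓ (λ h → f ((b ∷ r) ∷ h))) ⟩
    ∑[ r ∈ allF₂^ u ] ∑[ c ∈ allF₂^ ℓ ] ∑[ h ∈ allLinMaps u ℓ ] f ((b ∷ r) ∷ (c ∣∷ h))
      ≡⟨ ∑-swap (allF₂^ u) (allF₂^ ℓ) _ ⟩
    ∑[ c ∈ allF₂^ ℓ ] ∑[ r ∈ allF₂^ u ] ∑[ h ∈ allLinMaps u ℓ ] f ((b ∷ r) ∷ (c ∣∷ h))
      ≡⟨ ∑-cong (allF₂^ ℓ) (λ c → ∑-allVecsOf-suc (allF₂^ u) ℓ (λ h → f ((b ∷ c) ∣∷ h))) ⟨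
    cols b ∎

∑-LinMap-const : ∀ u ℓ k → ∑[ _ ∈ allLinMaps u ℓ ] k ≡ 2 ^ (ℓ ℕ.* u) ℕ.* k
∑-LinMap-const u zero    k = refl
∑-LinMap-const u (suc ℓ) k = begin
  ∑[ _ ∈ allLinMaps u (suc ℓ) ] k          ≡⟨ ∑-allVecsOf-suc (allF₂^ u) ℓ _ ⟩
  ∑[ _ ∈ allF₂^ u ] ∑[ _ ∈ allLinMaps u ℓ ] k ≡⟨ ∑-F₂^-const u _ ⟩
  2 ^ u ℕ.* ∑[ _ ∈ allLinMaps u ℓ ] k      ≡⟨ cong (2 ^ u ℕ.*_) (∑-LinMap-const u ℓ k) ⟩
  2 ^ u ℕ.* (2 ^ (ℓ ℕ.* u) ℕ.* k)          ≡⟨ ℕₚ.*-assoc (2 ^ u) _ k ⟨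
  2 ^ u ℕ.* 2 ^ (ℓ ℕ.* u) ℕ.* k            ≡⟨ cong (ℕ._* k) (ℕₚ.^-distribˡ-+-* 2 u (ℓ ℕ.* u)) ⟨
  2 ^ (u ℕ.+ ℓ ℕ.* u) ℕ.* k                ∎
  where open ≡-Reasoning

-- The random process

∑₂ : ∀ ℓ N → (F₂^ ℓ → F₂^ N → ℕ) → ℕ
∑₂ ℓ N F = ∑[ y ∈ allF₂^ ℓ ] ∑[ x ∈ allF₂^ N ] F y x

∑₂-cong : ∀ {ℓ N} {F G : F₂^ ℓ → F₂^ N → ℕ} → (∀ y x → F y x ≡ G y x) → ∑₂ ℓ N F ≡ ∑₂ ℓ N G
∑₂-cong F≗G = ∑-cong (allF₂^ _) λ y → ∑-cong (allF₂^ _) (F≗G y)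

∑₂-mono : ∀ {ℓ N} {F G : F₂^ ℓ → F₂^ N → ℕ} → (∀ y x → F y x ℕ.≤ G y x) → ∑₂ ℓ N F ℕ.≤ ∑₂ ℓ N G
∑₂-mono F≤G = ∑-mono (allF₂^ _) λ y → ∑-mono (allF₂^ _) (F≤G y)

∑₂-+ : ∀ ℓ N (F G : F₂^ ℓ → F₂^ N → ℕ) →
       ∑₂ ℓ N (λ y x → F y x ℕ.+ G y x) ≡ ∑₂ ℓ N F ℕ.+ ∑₂ ℓ N G
∑₂-+ ℓ N F G = trans (∑-cong (allF₂^ ℓ) λ y → ∑-+ (allF₂^ N) _ _) (∑-+ (allF₂^ ℓ) _ _)

∑₂-*ˡ : ∀ ℓ N k (F : F₂^ ℓ → F₂^ N → ℕ) → ∑₂ ℓ N (λ y x → k ℕ.* F y x) ≡ k ℕ.* ∑₂ ℓ N F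
∑₂-*ˡ ℓ N k F = trans (∑-cong (allF₂^ ℓ) λ y → ∑-*ˡ (allF₂^ N) k _) (∑-*ˡ (allF₂^ ℓ) k _)

∑₂-const : ∀ ℓ N k → ∑₂ ℓ N (λ _ _ → k) ≡ (2 ^ ℓ ℕ.* 2 ^ N) ℕ.* k
∑₂-const ℓ N k = trans (∑-F₂^-const ℓ _)
  (trans (cong (2 ^ ℓ ℕ.*_) (∑-F₂^-const N k)) (sym (ℕₚ.*-assoc (2 ^ ℓ) (2 ^ N) k)))

-- Fiber counts of `(y , x) ↦ y + h x`: in characteristic two the points above `y` are exactly the
-- `(y + h x , x)`.
push : ∀ {ℓ N} → (F₂^ ℓ → F₂^ N → ℕ) → LinMap N ℓ → F₂^ ℓ → ℕ
push {N = N} f h y = ∑[ x ∈ allF₂^ N ] f (y ⊕ apply h x) x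

-- Quotient of F₂^ℓ × F₂^(1+N) by the vector (v , 1 ∷ w).
merge : ∀ {ℓ N} → (F₂^ ℓ → F₂^ (suc N) → ℕ) → F₂^ ℓ → F₂^ N → F₂^ ℓ → F₂^ N → ℕ
merge f v w y x = f y (false ∷ x) ℕ.+ f (y ⊕ v) (true ∷ (x ⊕ w))

⊕-cancel-common : ∀ {n} (a b c : F₂^ n) → (a ⊕ b) ⊕ (c ⊕ b) ≡ c ⊕ a
⊕-cancel-common a b c = begin
  (a ⊕ b) ⊕ (c ⊕ b) ≡⟨ cong ((a ⊕ b) ⊕_) (⊕-comm c b) ⟩
  (a ⊕ b) ⊕ (b ⊕ c) ≡⟨ ⊕-assoc a b (b ⊕ c) ⟩
  a ⊕ (b ⊕ (b ⊕ c)) ≡⟨ cong (a ⊕_) (⊕-assoc b b c) ⟨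
  a ⊕ ((b ⊕ b) ⊕ c) ≡⟨ cong (λ z → a ⊕ (z ⊕ c)) (⊕-self b) ⟩
  a ⊕ (𝟎 ⊕ c)       ≡⟨ cong (a ⊕_) (trans (⊕-comm 𝟎 c) (⊕-identityʳ c)) ⟩
  a ⊕ c             ≡⟨ ⊕-comm a c ⟩
  c ⊕ a             ∎
  where open ≡-Reasoning

-- The map `(y , x) ↦ y + (c ∣∷ h) x` kills `(v , 1 ∷ w)` precisely when `c = v + h w`; it then
-- factors through the quotient, where `h` describes it.
push-merge : ∀ {ℓ N} (f : F₂^ ℓ → F₂^ (suc N) → ℕ) v w h y →
             push f ((v ⊕ apply h w) ∣∷ h) y ≡ push (merge f v w) h y
push-merge {ℓ} {N} f v w h y = begin
  push f (c ∣∷ h) y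
    ≡⟨ ∑-F₂^-suc N _ ⟩
  ∑[ x ∈ allF₂^ N ] f (y ⊕ apply (c ∣∷ h) (false ∷ x)) (false ∷ x) ℕ.+
  ∑[ x ∈ allF₂^ N ] f (y ⊕ apply (c ∣∷ h) (true ∷ x)) (true ∷ x)
    ≡⟨ cong₂ ℕ._+_
         (∑-cong (allF₂^ N) λ x → cong (λ z → f (y ⊕ z) (false ∷ x)) (apply-∣∷-false c h x))
         -- The shift by `w` aligns each point of the `true` half with the point of the `false` half
         -- it is identified with.
         (trans (sym (∑-translateʳ w _)) (∑-cong (allF₂^ N) λ x →
           cong (λ z → f z (true ∷ (x ⊕ w))) (shift x))) ⟩
  ∑[ x ∈ allF₂^ N ] f (y ⊕ apply h x) (false ∷ x) ℕ.+
  ∑[ x ∈ allF₂^ N ] f ((y ⊕ apply h x) ⊕ v) (true ∷ (x ⊕ w))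
    ≡⟨ ∑-+ (allF₂^ N) _ _ ⟨
  push (merge f v w) h y ∎
  where
  open ≡-Reasoning
  c = v ⊕ apply h w
  shift : ∀ x → y ⊕ apply (c ∣∷ h) (true ∷ (x ⊕ w)) ≡ (y ⊕ apply h x) ⊕ v
  shift x = begin
    y ⊕ apply (c ∣∷ h) (true ∷ (x ⊕ w))          ≡⟨ cong (y ⊕_) (apply-∣∷-true c h (x ⊕ w)) ⟩
    y ⊕ (c ⊕ apply h (x ⊕ w))                    ≡⟨ cong (λ z → y ⊕ (c ⊕ z)) (apply-⊕ h x w) ⟩
    y ⊕ ((v ⊕ apply h w) ⊕ (apply h x ⊕ apply h w)) ≡⟨ cong (y ⊕_) (⊕-cancel-common v _ _) ⟩
    y ⊕ (apply h x ⊕ v)                          ≡⟨ ⊕-assoc y _ v ⟨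
    (y ⊕ apply h x) ⊕ v                          ∎

-- Inequalities for a single step

4xy≤[x+y]² : ∀ x y → 4 ℕ.* (x ℕ.* y) ℕ.≤ (x ℕ.+ y) ℕ.* (x ℕ.+ y)
4xy≤[x+y]² x y with ℕₚ.≤-total x y
... | inj₁ x≤y = subst (λ z → 4 ℕ.* (x ℕ.* z) ℕ.≤ (x ℕ.+ z) ℕ.* (x ℕ.+ z)) (ℕₚ.m+[n∸m]≡n x≤y)
                   (ℕₚ.≤-trans (ℕₚ.m≤m+n _ _) (ℕₚ.≤-reflexive (expand x (y ℕ.∸ x))))
  where
  expand : ∀ x d → 4 ℕ.* (x ℕ.* (x ℕ.+ d)) ℕ.+ d ℕ.* d ≡ (x ℕ.+ (x ℕ.+ d)) ℕ.* (x ℕ.+ (x ℕ.+ d))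
  expand = solve-∀
... | inj₂ y≤x = subst (λ z → 4 ℕ.* (z ℕ.* y) ℕ.≤ (z ℕ.+ y) ℕ.* (z ℕ.+ y)) (ℕₚ.m+[n∸m]≡n y≤x)
                   (ℕₚ.≤-trans (ℕₚ.m≤m+n _ _) (ℕₚ.≤-reflexive (expand y (x ℕ.∸ y))))
  where
  expand : ∀ y d → 4 ℕ.* ((y ℕ.+ d) ℕ.* y) ℕ.+ d ℕ.* d ≡ (y ℕ.+ d ℕ.+ y) ℕ.* (y ℕ.+ d ℕ.+ y)
  expand = solve-∀

sq : ℕ → ℕ
sq x = x ℕ.* x

[q+z]² : ∀ q z → (q ℕ.+ z) ℕ.* (q ℕ.+ z) ≡ q ℕ.* q ℕ.+ (q ℕ.+ (q ℕ.+ z)) ℕ.* z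
[q+z]² = solve-∀

q²+2pz : ∀ p q z → q ℕ.* q ℕ.+ (p ℕ.+ p) ℕ.* z ≡ q ℕ.* q ℕ.+ 2 ℕ.* p ℕ.* z
q²+2pz = solve-∀

-- min((q + z)², p²) lies below the line q² + 2pz when q ≤ p; unlike (q + z)² itself, the
-- line can be averaged knowing only the mean of z.
truncated-square : ∀ {c k p q z} → c ℕ.≤ k → q ℕ.≤ p →
                   c ℕ.* (p ℕ.* p) ℕ.≤ k ℕ.* ((q ℕ.+ z) ℕ.* (q ℕ.+ z)) →
                   c ℕ.* (p ℕ.* p) ℕ.≤ k ℕ.* (q ℕ.* q ℕ.+ 2 ℕ.* p ℕ.* z)
truncated-square {c} {k} {p} {q} {z} c≤k q≤p bound with ℕₚ.≤-total (q ℕ.+ z) p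
... | inj₁ q+z≤p = ℕₚ.≤-trans bound (ℕₚ.*-monoʳ-≤ k (begin
  (q ℕ.+ z) ℕ.* (q ℕ.+ z)                       ≡⟨ [q+z]² q z ⟩
  q ℕ.* q ℕ.+ (q ℕ.+ (q ℕ.+ z)) ℕ.* z           ≤⟨ ℕₚ.+-monoʳ-≤ (q ℕ.* q) (ℕₚ.*-monoˡ-≤ z
                                                     (ℕₚ.+-mono-≤ q≤p q+z≤p)) ⟩
  q ℕ.* q ℕ.+ (p ℕ.+ p) ℕ.* z                   ≡⟨ q²+2pz p q z ⟩
  q ℕ.* q ℕ.+ 2 ℕ.* p ℕ.* z                     ∎))
  where
  open ℕₚ.≤-Reasoning
... | inj₂ p≤q+z = ℕₚ.*-mono-≤ c≤k (begin
  p ℕ.* p                                       ≡⟨ cong (λ t → t ℕ.* t) (sym q+d≡p) ⟩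
  (q ℕ.+ d) ℕ.* (q ℕ.+ d)                       ≡⟨ [q+z]² q d ⟩
  q ℕ.* q ℕ.+ (q ℕ.+ (q ℕ.+ d)) ℕ.* d           ≤⟨ ℕₚ.+-monoʳ-≤ (q ℕ.* q) (ℕₚ.*-mono-≤
                                                     (ℕₚ.+-mono-≤ q≤p (ℕₚ.≤-reflexive q+d≡p))
                                                     (ℕₚ.m≤n+o⇒m∸n≤o p q p≤q+z)) ⟩
  q ℕ.* q ℕ.+ (p ℕ.+ p) ℕ.* z                   ≡⟨ q²+2pz p q z ⟩
  q ℕ.* q ℕ.+ 2 ℕ.* p ℕ.* z                     ∎)
  where
  open ℕₚ.≤-Reasoning
  d = p ℕ.∸ q
  q+d≡p : q ℕ.+ d ≡ p
  q+d≡p = ℕₚ.m+[n∸m]≡n q≤p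

-- A threshold A = s / d for the mean excess turns into 2A(1 + A) = 2s(d + s) / d² after one
-- merge, so that 1 + 2A is squared.
num den : ℕ → ℕ → ℕ → ℕ
num zero    s d = s
num (suc N) s d = num N (2 ℕ.* s ℕ.* (d ℕ.+ s)) (d ℕ.* d)
den zero    s d = d
den (suc N) s d = den N (2 ℕ.* s ℕ.* (d ℕ.+ s)) (d ℕ.* d)

-- Put `A = s / d`, `B = 2A(1 + A)` and `ε = E / 2v`. After division the hypothesis is
-- `c B² ≤ k v (4 + 2B) ε²` and the conclusion `c A² ≤ k v ε²`. Since `4 + 2B = 4 + 4A + 4A²` falls
-- short of `4(1 + A)²` by `4A`, the proof adds that missing term and cancels the square.
threshold-step : ∀ s d .{{_ : NonZero d}} c k v E →
  let p = 2 ℕ.* s ℕ.* (d ℕ.+ s) ℕ.* v in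
  2 ℕ.* (c ℕ.* sq p) ℕ.≤ k ℕ.* (2 ℕ.* v ℕ.* sq (d ℕ.* d ℕ.* E) ℕ.+ p ℕ.* (d ℕ.* d) ℕ.* sq E) →
  c ℕ.* sq (2 ℕ.* s ℕ.* v) ℕ.≤ k ℕ.* v ℕ.* sq (d ℕ.* E)
threshold-step s d c k v E bound =
  ℕₚ.*-cancelˡ-≤ (2 ℕ.* sq (d ℕ.+ s)) {{ℕₚ.m*n≢0 2 _ {{_}} {{ℕₚ.m*n≢0 _ _ {{d+s≢0}} {{d+s≢0}}}}}} (begin
    2 ℕ.* sq (d ℕ.+ s) ℕ.* (c ℕ.* sq (2 ℕ.* s ℕ.* v))
      ≡⟨ lhs s (d ℕ.+ s) c v ⟩
    2 ℕ.* (c ℕ.* sq p)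
      ≤⟨ bound ⟩
    k ℕ.* (2 ℕ.* v ℕ.* sq (d ℕ.* d ℕ.* E) ℕ.+ p ℕ.* (d ℕ.* d) ℕ.* sq E)
      ≤⟨ ℕₚ.m≤m+n _ (2 ℕ.* (k ℕ.* v ℕ.* sq (d ℕ.* E)) ℕ.* (s ℕ.* d)) ⟩
    k ℕ.* (2 ℕ.* v ℕ.* sq (d ℕ.* d ℕ.* E) ℕ.+ p ℕ.* (d ℕ.* d) ℕ.* sq E)
      ℕ.+ 2 ℕ.* (k ℕ.* v ℕ.* sq (d ℕ.* E)) ℕ.* (s ℕ.* d)
      ≡⟨ rhs s d k v E ⟩
    2 ℕ.* sq (d ℕ.+ s) ℕ.* (k ℕ.* v ℕ.* sq (d ℕ.* E)) ∎)
  where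
  open ℕₚ.≤-Reasoning
  p = 2 ℕ.* s ℕ.* (d ℕ.+ s) ℕ.* v
  d+s≢0 : NonZero (d ℕ.+ s)
  d+s≢0 = ℕ.>-nonZero (ℕₚ.≤-trans (ℕ.>-nonZero⁻¹ d) (ℕₚ.m≤m+n d s))
  lhs : ∀ s x c v → 2 ℕ.* (x ℕ.* x) ℕ.* (c ℕ.* (2 ℕ.* s ℕ.* v ℕ.* (2 ℕ.* s ℕ.* v)))
      ≡ 2 ℕ.* (c ℕ.* (2 ℕ.* s ℕ.* x ℕ.* v ℕ.* (2 ℕ.* s ℕ.* x ℕ.* v)))
  lhs = solve-∀
  rhs : ∀ s d k v E →
    k ℕ.* (2 ℕ.* v ℕ.* (d ℕ.* d ℕ.* E ℕ.* (d ℕ.* d ℕ.* E))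
           ℕ.+ 2 ℕ.* s ℕ.* (d ℕ.+ s) ℕ.* v ℕ.* (d ℕ.* d) ℕ.* (E ℕ.* E))
      ℕ.+ 2 ℕ.* (k ℕ.* v ℕ.* (d ℕ.* E ℕ.* (d ℕ.* E))) ℕ.* (s ℕ.* d)
    ≡ 2 ℕ.* ((d ℕ.+ s) ℕ.* (d ℕ.+ s)) ℕ.* (k ℕ.* v ℕ.* (d ℕ.* E ℕ.* (d ℕ.* E)))
  rhs = solve-∀

-- Energy and the inductive tail bound

-- The hypothesis says that `1 + e` turns sums into products. Nothing else about `a^k - 1` drives
-- the process, so `e` stays abstract until `a` is chosen.
module Process (e : ℕ → ℕ) (e-+ : ∀ i j → e (i ℕ.+ j) ≡ e i ℕ.+ e j ℕ.+ e i ℕ.* e j) where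

  energy : ∀ {ℓ N} → (F₂^ ℓ → F₂^ N → ℕ) → ℕ
  energy {ℓ} {N} f = ∑₂ ℓ N λ y x → e (f y x)

  half : ∀ {ℓ N} → Bool → (F₂^ ℓ → F₂^ (suc N) → ℕ) → F₂^ ℓ → F₂^ N → ℕ
  half b f y x = f y (b ∷ x)

  cross : ∀ {ℓ N} (f : F₂^ ℓ → F₂^ (suc N) → ℕ) → F₂^ ℓ → F₂^ N → ℕ
  cross {ℓ} {N} f v w = ∑₂ ℓ N λ y x → e (half false f y x) ℕ.* e (half true f (y ⊕ v) (x ⊕ w))

  energy-halves : ∀ {ℓ N} (f : F₂^ ℓ → F₂^ (suc N) → ℕ) →
                  energy f ≡ energy (half false f) ℕ.+ energy (half true f)
  energy-halves {ℓ} {N} f = trans (∑-cong (allF₂^ ℓ) λ y → ∑-F₂^-suc N _) (∑-+ (allF₂^ ℓ) _ _)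

  -- The linear terms of `e-+` add up to the old total, now spread over half as many points, which
  -- doubles the mean; `cross` is the random remainder.
  energy-merge : ∀ {ℓ N} (f : F₂^ ℓ → F₂^ (suc N) → ℕ) v w →
                 energy (merge f v w) ≡ energy f ℕ.+ cross f v w
  energy-merge {ℓ} {N} f v w = begin
    energy (merge f v w)
      ≡⟨ ∑₂-cong (λ y x → e-+ (f₀ y x) (f₁ (y ⊕ v) (x ⊕ w))) ⟩
    ∑₂ ℓ N (λ y x → e (f₀ y x) ℕ.+ e (f₁ (y ⊕ v) (x ⊕ w)) ℕ.+ e (f₀ y x) ℕ.* e (f₁ (y ⊕ v) (x ⊕ w)))
      ≡⟨ ∑₂-+ ℓ N _ _ ⟩
    ∑₂ ℓ N (λ y x → e (f₀ y x) ℕ.+ e (f₁ (y ⊕ v) (x ⊕ w))) ℕ.+ cross f v w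
      ≡⟨ cong (ℕ._+ cross f v w) (∑₂-+ ℓ N _ _) ⟩
    energy f₀ ℕ.+ ∑₂ ℓ N (λ y x → e (f₁ (y ⊕ v) (x ⊕ w))) ℕ.+ cross f v w
      ≡⟨ cong (λ z → energy f₀ ℕ.+ z ℕ.+ cross f v w)
           (trans (∑-cong (allF₂^ ℓ) λ y → ∑-translateʳ w λ x → e (f₁ (y ⊕ v) x))
                  (∑-translateʳ v λ y → ∑[ x ∈ allF₂^ N ] e (f₁ y x))) ⟩
    energy f₀ ℕ.+ energy f₁ ℕ.+ cross f v w
      ≡⟨ cong (ℕ._+ cross f v w) (energy-halves f) ⟨
    energy f ℕ.+ cross f v w ∎
    where
    open ≡-Reasoning
    f₀ = half false f
    f₁ = half true f

  -- For a fixed point of the `false` half, its partner runs once through the whole `true` half as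
  -- `(v , w)` varies, so the sum of products factors.
  ∑-cross : ∀ {ℓ N} (f : F₂^ ℓ → F₂^ (suc N) → ℕ) →
            ∑₂ ℓ N (cross f) ≡ energy (half false f) ℕ.* energy (half true f)
  ∑-cross {ℓ} {N} f = begin
    ∑[ v ∈ Y ] ∑[ w ∈ X ] ∑[ y ∈ Y ] ∑[ x ∈ X ] g v w y x
      ≡⟨ ∑-cong Y (λ v → ∑-swap X Y _) ⟩
    ∑[ v ∈ Y ] ∑[ y ∈ Y ] ∑[ w ∈ X ] ∑[ x ∈ X ] g v w y x
      ≡⟨ ∑-swap Y Y _ ⟩
    ∑[ y ∈ Y ] ∑[ v ∈ Y ] ∑[ w ∈ X ] ∑[ x ∈ X ] g v w y x
      ≡⟨ ∑-cong Y (λ y → ∑-cong Y λ v → ∑-swap X X _) ⟩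
    ∑[ y ∈ Y ] ∑[ v ∈ Y ] ∑[ x ∈ X ] ∑[ w ∈ X ] g v w y x
      ≡⟨ ∑-cong Y (λ y → ∑-swap Y X _) ⟩
    ∑[ y ∈ Y ] ∑[ x ∈ X ] ∑[ v ∈ Y ] ∑[ w ∈ X ] g v w y x
      ≡⟨ ∑-cong Y (λ y → ∑-cong X λ x → inner y x) ⟩
    ∑[ y ∈ Y ] ∑[ x ∈ X ] (e (f₀ y x) ℕ.* energy f₁)
      ≡⟨ ∑-cong Y (λ y → ∑-*ʳ X (energy f₁) _) ⟩
    ∑[ y ∈ Y ] (∑[ x ∈ X ] e (f₀ y x) ℕ.* energy f₁)
      ≡⟨ ∑-*ʳ Y (energy f₁) _ ⟩
    energy f₀ ℕ.* energy f₁ ∎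
    where
    open ≡-Reasoning
    X = allF₂^ N
    Y = allF₂^ ℓ
    f₀ = half false f
    f₁ = half true f
    g : F₂^ ℓ → F₂^ N → F₂^ ℓ → F₂^ N → ℕ
    g v w y x = e (f₀ y x) ℕ.* e (f₁ (y ⊕ v) (x ⊕ w))
    inner : ∀ y x → ∑[ v ∈ Y ] ∑[ w ∈ X ] g v w y x ≡ e (f₀ y x) ℕ.* energy f₁
    inner y x = begin
      ∑[ v ∈ Y ] ∑[ w ∈ X ] g v w y x
        ≡⟨ ∑-cong Y (λ v → trans (∑-*ˡ X (e (f₀ y x)) _)
             (cong (e (f₀ y x) ℕ.*_) (∑-translate x λ w → e (f₁ (y ⊕ v) w)))) ⟩
      ∑[ v ∈ Y ] (e (f₀ y x) ℕ.* ∑[ w ∈ X ] e (f₁ (y ⊕ v) w))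
        ≡⟨ ∑-*ˡ Y (e (f₀ y x)) _ ⟩
      e (f₀ y x) ℕ.* ∑[ v ∈ Y ] ∑[ w ∈ X ] e (f₁ (y ⊕ v) w)
        ≡⟨ cong (e (f₀ y x) ℕ.*_) (∑-translate y λ v → ∑[ w ∈ X ] e (f₁ v w)) ⟩
      e (f₀ y x) ℕ.* energy f₁ ∎

  outcome : ∀ {ℓ N} → (F₂^ ℓ → F₂^ N → ℕ) → LinMap N ℓ → ℕ
  outcome {ℓ} f h = ∑[ y ∈ allF₂^ ℓ ] e (push f h y)

  module _ (ι : ℕ → ℕ) (ι≤1 : ∀ E → ι E ℕ.≤ 1) where

    count : ∀ {ℓ N} → (F₂^ ℓ → F₂^ N → ℕ) → ℕ
    count {ℓ} {N} f = ∑[ h ∈ allLinMaps N ℓ ] ι (outcome f h)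

    count≤ : ∀ {ℓ N} (f : F₂^ ℓ → F₂^ N → ℕ) → count f ℕ.≤ 2 ^ (ℓ ℕ.* N)
    count≤ {ℓ} {N} f = begin
      count f                      ≤⟨ ∑-mono (allLinMaps N ℓ) (λ h → ι≤1 _) ⟩
      ∑[ _ ∈ allLinMaps N ℓ ] 1    ≡⟨ ∑-LinMap-const N ℓ 1 ⟩
      2 ^ (ℓ ℕ.* N) ℕ.* 1          ≡⟨ ℕₚ.*-identityʳ _ ⟩
      2 ^ (ℓ ℕ.* N)                ∎
      where open ℕₚ.≤-Reasoning

    -- For fixed h and w the first column v ⊕ h w is uniform when v is.
    ∑-count-merge : ∀ {ℓ N} (f : F₂^ ℓ → F₂^ (suc N) → ℕ) →
                    ∑₂ ℓ N (λ v w → count (merge f v w)) ≡ 2 ^ N ℕ.* count f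
    ∑-count-merge {ℓ} {N} f = begin
      ∑[ v ∈ Y ] ∑[ w ∈ X ] ∑[ h ∈ H ] ι (outcome (merge f v w) h)
        ≡⟨ ∑-cong Y (λ v → ∑-cong X λ w → ∑-cong H λ h → cong ι
             (∑-cong Y λ y → cong e (push-merge f v w h y))) ⟨
      ∑[ v ∈ Y ] ∑[ w ∈ X ] ∑[ h ∈ H ] ι (outcome f ((v ⊕ apply h w) ∣∷ h))
        ≡⟨ ∑-swap Y X _ ⟩
      ∑[ w ∈ X ] ∑[ v ∈ Y ] ∑[ h ∈ H ] ι (outcome f ((v ⊕ apply h w) ∣∷ h))
        ≡⟨ ∑-cong X (λ w → ∑-swap Y H _) ⟩
      ∑[ w ∈ X ] ∑[ h ∈ H ] ∑[ v ∈ Y ] ι (outcome f ((v ⊕ apply h w) ∣∷ h))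
        ≡⟨ ∑-cong X (λ w → ∑-cong H λ h →
             ∑-translateʳ (apply h w) λ c → ι (outcome f (c ∣∷ h))) ⟩
      ∑[ w ∈ X ] ∑[ h ∈ H ] ∑[ c ∈ Y ] ι (outcome f (c ∣∷ h))
        ≡⟨ ∑-F₂^-const N _ ⟩
      2 ^ N ℕ.* ∑[ h ∈ H ] ∑[ c ∈ Y ] ι (outcome f (c ∣∷ h))
        ≡⟨ cong (2 ^ N ℕ.*_) (trans (∑-swap H Y _) (sym (∑-LinMap-suc N ℓ _))) ⟩
      2 ^ N ℕ.* count f ∎
      where
      open ≡-Reasoning
      X = allF₂^ N
      Y = allF₂^ ℓ
      H = allLinMaps N ℓ

    -- In cleared form this is `Pr ≤ (ε / A)²`, with `A = s / d` and `ε` the mean excess of `f`;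
    -- `ι-bound` is the case where no coordinate is left. In the step the induction hypothesis is
    -- applied to every `merge f v w` with threshold `2A(1 + A)`, capped at `1`, and averaged over
    -- `(v , w)`.
    tail-bound : ∀ {ℓ} N s d .{{_ : NonZero d}} →
                 (∀ E → ι E ℕ.* sq (num N s d ℕ.* 2 ^ ℓ) ℕ.≤ sq (den N s d ℕ.* E)) →
                 ∀ (f : F₂^ ℓ → F₂^ N → ℕ) →
                 count f ℕ.* sq (s ℕ.* (2 ^ ℓ ℕ.* 2 ^ N)) ℕ.≤ 2 ^ (ℓ ℕ.* N) ℕ.* sq (d ℕ.* energy f)
    tail-bound {ℓ} zero s d ι-bound f = begin
      count f ℕ.* sq (s ℕ.* (2 ^ ℓ ℕ.* 1))
        ≡⟨ cong₂ (λ a b → a ℕ.* sq (s ℕ.* b)) (∑-LinMap-zero ℓ _) (ℕₚ.*-identityʳ (2 ^ ℓ)) ⟩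
      ι (outcome f h) ℕ.* sq (s ℕ.* 2 ^ ℓ)
        ≤⟨ ι-bound _ ⟩
      sq (d ℕ.* outcome f h)
        ≡⟨ cong (λ a → sq (d ℕ.* a)) outcome≡energy ⟩
      sq (d ℕ.* energy f)
        ≡⟨ ℕₚ.*-identityˡ _ ⟨
      1 ℕ.* sq (d ℕ.* energy f)
        ≡⟨ cong (λ a → 2 ^ a ℕ.* sq (d ℕ.* energy f)) (ℕₚ.*-zeroʳ ℓ) ⟨
      2 ^ (ℓ ℕ.* 0) ℕ.* sq (d ℕ.* energy f) ∎
      where
      open ℕₚ.≤-Reasoning
      h : LinMap 0 ℓ
      h = replicate ℓ []
      outcome≡energy : outcome f h ≡ energy f
      outcome≡energy = trans
        (∑-cong (allF₂^ ℓ) λ y → trans (cong e (ℕₚ.+-identityʳ _)) (sym (ℕₚ.+-identityʳ _)))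
        -- Treating the value of the column-free map as an arbitrary translation avoids identifying
        -- it with zero.
        (∑-translateʳ (apply h []) λ y → ∑[ x ∈ allF₂^ 0 ] e (f y x))
    tail-bound {ℓ} (suc N) s d ι-bound f =
      ℕₚ.*-cancelˡ-≤ (2 ^ N) {{m^n≢0 2 N}} (begin
        2 ^ N ℕ.* (count f ℕ.* sq (s ℕ.* (2 ^ ℓ ℕ.* (2 ℕ.* 2 ^ N))))
          ≡⟨ regroup (2 ^ N) (count f) s (2 ^ ℓ) ⟩
        2 ^ N ℕ.* count f ℕ.* sq (2 ℕ.* s ℕ.* V)
          ≡⟨ cong (ℕ._* sq (2 ℕ.* s ℕ.* V)) (∑-count-merge f) ⟨
        total ℕ.* sq (2 ℕ.* s ℕ.* V)
          ≤⟨ total-bound ⟩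
        K ℕ.* V ℕ.* sq (d ℕ.* E)
          ≡⟨ regroup′ K (2 ^ ℓ) (2 ^ N) (sq (d ℕ.* E)) ⟩
        2 ^ N ℕ.* (2 ^ ℓ ℕ.* K ℕ.* sq (d ℕ.* E))
          ≡⟨ cong (λ k → 2 ^ N ℕ.* (k ℕ.* sq (d ℕ.* E))) (trans
               (cong (2 ^_) (ℕₚ.*-suc ℓ N)) (ℕₚ.^-distribˡ-+-* 2 ℓ (ℓ ℕ.* N))) ⟨
        2 ^ N ℕ.* (2 ^ (ℓ ℕ.* suc N) ℕ.* sq (d ℕ.* E)) ∎)
      where
      open ℕₚ.≤-Reasoning
      V K E E₀ E₁ P Q total : ℕ
      V  = 2 ^ ℓ ℕ.* 2 ^ N
      K  = 2 ^ (ℓ ℕ.* N)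
      E  = energy f
      E₀ = energy (half false f)
      E₁ = energy (half true f)
      -- Over the common denominator `d² V`, `P` is the new threshold `B = 2A(1 + A)` and `Q` is
      -- `2ε`.
      P  = 2 ℕ.* s ℕ.* (d ℕ.+ s) ℕ.* V
      Q  = d ℕ.* d ℕ.* E
      total = ∑₂ ℓ N λ v w → count (merge f v w)

      regroup : ∀ n c s l → n ℕ.* (c ℕ.* (s ℕ.* (l ℕ.* (2 ℕ.* n)) ℕ.* (s ℕ.* (l ℕ.* (2 ℕ.* n)))))
                          ≡ n ℕ.* c ℕ.* (2 ℕ.* s ℕ.* (l ℕ.* n) ℕ.* (2 ℕ.* s ℕ.* (l ℕ.* n)))
      regroup = solve-∀
      regroup′ : ∀ k l n x → k ℕ.* (l ℕ.* n) ℕ.* x ≡ n ℕ.* (l ℕ.* k ℕ.* x)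
      regroup′ = solve-∀

      total-bound : total ℕ.* sq (2 ℕ.* s ℕ.* V) ℕ.≤ K ℕ.* V ℕ.* sq (d ℕ.* E)
      -- If `ε ≥ A`, the claimed bound is at least `1`. Otherwise `2ε ≤ 2A ≤ B`, which is what the
      -- truncation requires.
      total-bound with ℕₚ.≤-total (2 ℕ.* s ℕ.* V) (d ℕ.* E)
      ... | inj₁ large = ℕₚ.*-mono-≤ total≤ (ℕₚ.*-mono-≤ large large)
        where
        total≤ : total ℕ.≤ K ℕ.* V
        total≤ = ℕₚ.≤-trans (∑₂-mono λ v w → count≤ (merge f v w))
                            (ℕₚ.≤-reflexive (trans (∑₂-const ℓ N K) (ℕₚ.*-comm V K)))
      ... | inj₂ small = threshold-step s d total K V E (begin
        2 ℕ.* (total ℕ.* sq P)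
          ≡⟨ cong (2 ℕ.*_) (trans (sym (∑-*ʳ (allF₂^ ℓ) (sq P) _))
               (∑-cong (allF₂^ ℓ) λ v → sym (∑-*ʳ (allF₂^ N) (sq P) _))) ⟩
        2 ℕ.* ∑₂ ℓ N (λ v w → count (merge f v w) ℕ.* sq P)
          ≤⟨ ℕₚ.*-monoʳ-≤ 2 (∑₂-mono pointwise) ⟩
        2 ℕ.* ∑₂ ℓ N (λ v w → K ℕ.* (sq Q ℕ.+ 2 ℕ.* P ℕ.* (d ℕ.* d ℕ.* cross f v w)))
          ≡⟨ cong (2 ℕ.*_) average ⟩
        2 ℕ.* (K ℕ.* (V ℕ.* sq Q ℕ.+ 2 ℕ.* P ℕ.* (d ℕ.* d) ℕ.* (E₀ ℕ.* E₁)))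
          ≡⟨ pull K V (sq Q) P (d ℕ.* d) (E₀ ℕ.* E₁) ⟩
        K ℕ.* (2 ℕ.* V ℕ.* sq Q ℕ.+ P ℕ.* (d ℕ.* d) ℕ.* (4 ℕ.* (E₀ ℕ.* E₁)))
          -- Only the sum `E₀ + E₁ = E` is controlled; AM-GM bounds the mean of `cross / V` by `ε²`.
          -- The overall factor `2` supplies the `4` without division.
          ≤⟨ ℕₚ.*-monoʳ-≤ K (ℕₚ.+-monoʳ-≤ (2 ℕ.* V ℕ.* sq Q)
               (ℕₚ.*-monoʳ-≤ (P ℕ.* (d ℕ.* d)) (4xy≤[x+y]² E₀ E₁))) ⟩
        K ℕ.* (2 ℕ.* V ℕ.* sq Q ℕ.+ P ℕ.* (d ℕ.* d) ℕ.* sq (E₀ ℕ.+ E₁))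
          ≡⟨ cong (λ z → K ℕ.* (2 ℕ.* V ℕ.* sq Q ℕ.+ P ℕ.* (d ℕ.* d) ℕ.* sq z)) (energy-halves f) ⟨
        K ℕ.* (2 ℕ.* V ℕ.* sq Q ℕ.+ P ℕ.* (d ℕ.* d) ℕ.* sq E) ∎)
        where
        pull : ∀ k v a p d x → 2 ℕ.* (k ℕ.* (v ℕ.* a ℕ.+ 2 ℕ.* p ℕ.* d ℕ.* x))
                           ≡ k ℕ.* (2 ℕ.* v ℕ.* a ℕ.+ p ℕ.* d ℕ.* (4 ℕ.* x))
        pull = solve-∀

        Q≤P : Q ℕ.≤ P
        Q≤P = begin
          d ℕ.* d ℕ.* E                      ≡⟨ ℕₚ.*-assoc d d E ⟩
          d ℕ.* (d ℕ.* E)                    ≤⟨ ℕₚ.*-mono-≤ (ℕₚ.m≤m+n d s) small ⟩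
          (d ℕ.+ s) ℕ.* (2 ℕ.* s ℕ.* V)      ≡⟨ commute (d ℕ.+ s) s V ⟩
          P                                  ∎
          where
          commute : ∀ x s v → x ℕ.* (2 ℕ.* s ℕ.* v) ≡ 2 ℕ.* s ℕ.* x ℕ.* v
          commute = solve-∀

        pointwise : ∀ v w → count (merge f v w) ℕ.* sq P ℕ.≤
                            K ℕ.* (sq Q ℕ.+ 2 ℕ.* P ℕ.* (d ℕ.* d ℕ.* cross f v w))
        pointwise v w = truncated-square (count≤ (merge f v w)) Q≤P (begin
          count (merge f v w) ℕ.* sq P
            -- `num` and `den` carry the threshold as an accumulator, so `ι-bound` for `suc N` is by
            -- definition the one for `N` at the updated threshold.
            ≤⟨ tail-bound N _ (d ℕ.* d) {{ℕₚ.m*n≢0 d d}} ι-bound (merge f v w) ⟩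
          K ℕ.* sq (d ℕ.* d ℕ.* energy (merge f v w))
            ≡⟨ cong (λ z → K ℕ.* sq z) (trans (cong (d ℕ.* d ℕ.*_) (energy-merge f v w))
                 (ℕₚ.*-distribˡ-+ (d ℕ.* d) E (cross f v w))) ⟩
          K ℕ.* sq (Q ℕ.+ d ℕ.* d ℕ.* cross f v w) ∎)

        average : ∑₂ ℓ N (λ v w → K ℕ.* (sq Q ℕ.+ 2 ℕ.* P ℕ.* (d ℕ.* d ℕ.* cross f v w)))
                ≡ K ℕ.* (V ℕ.* sq Q ℕ.+ 2 ℕ.* P ℕ.* (d ℕ.* d) ℕ.* (E₀ ℕ.* E₁))
        average = begin-equality
          ∑₂ ℓ N (λ v w → K ℕ.* (sq Q ℕ.+ 2 ℕ.* P ℕ.* (d ℕ.* d ℕ.* cross f v w)))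
            ≡⟨ ∑₂-*ˡ ℓ N K _ ⟩
          K ℕ.* ∑₂ ℓ N (λ v w → sq Q ℕ.+ 2 ℕ.* P ℕ.* (d ℕ.* d ℕ.* cross f v w))
            ≡⟨ cong (K ℕ.*_) (∑₂-+ ℓ N _ _) ⟩
          K ℕ.* (∑₂ ℓ N (λ _ _ → sq Q) ℕ.+ ∑₂ ℓ N (λ v w → 2 ℕ.* P ℕ.* (d ℕ.* d ℕ.* cross f v w)))
            ≡⟨ cong (K ℕ.*_) (cong₂ ℕ._+_ (∑₂-const ℓ N (sq Q)) (trans (∑₂-*ˡ ℓ N (2 ℕ.* P) _)
                 (trans (cong (2 ℕ.* P ℕ.*_) (trans (∑₂-*ˡ ℓ N (d ℕ.* d) _)
                   (cong (d ℕ.* d ℕ.*_) (∑-cross f)))) (sym (ℕₚ.*-assoc (2 ℕ.* P) _ _))))) ⟩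
          K ℕ.* (V ℕ.* sq Q ℕ.+ 2 ℕ.* P ℕ.* (d ℕ.* d) ℕ.* (E₀ ℕ.* E₁)) ∎

-- Powers and thresholds

*-swapˡ : ∀ a b c → a ℕ.* (b ℕ.* c) ≡ b ℕ.* (a ℕ.* c)
*-swapˡ = solve-∀

^-distribʳ-* : ∀ a b n → (a ℕ.* b) ^ n ≡ a ^ n ℕ.* b ^ n
^-distribʳ-* a b zero    = refl
^-distribʳ-* a b (suc n) = trans (cong ((a ℕ.* b) ℕ.*_) (^-distribʳ-* a b n))
                                 (interchange* a b (a ^ n) (b ^ n))
  where
  interchange* : ∀ a b c d → (a ℕ.* b) ℕ.* (c ℕ.* d) ≡ (a ℕ.* c) ℕ.* (b ℕ.* d)
  interchange* = solve-∀

^-square : ∀ a N → sq a ^ (2 ^ N) ≡ a ^ (2 ^ suc N)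
^-square a N = trans (cong (_^ (2 ^ N)) (cong (a ℕ.*_) (sym (ℕₚ.*-identityʳ a))))
                     (ℕₚ.^-*-assoc a 2 (2 ^ N))

den≡ : ∀ N s d → den N s d ≡ d ^ (2 ^ N)
den≡ zero    s d = sym (ℕₚ.*-identityʳ d)
den≡ (suc N) s d = trans (den≡ N (2 ℕ.* s ℕ.* (d ℕ.+ s)) (sq d)) (^-square d N)

den+2num≡ : ∀ N s d → den N s d ℕ.+ 2 ℕ.* num N s d ≡ (d ℕ.+ 2 ℕ.* s) ^ (2 ^ N)
den+2num≡ zero    s d = sym (ℕₚ.*-identityʳ _)
den+2num≡ (suc N) s d = trans (den+2num≡ N (2 ℕ.* s ℕ.* (d ℕ.+ s)) (sq d))
                       (trans (cong (_^ (2 ^ N)) (complete-square s d)) (^-square (d ℕ.+ 2 ℕ.* s) N))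
  where
  complete-square : ∀ s d → d ℕ.* d ℕ.+ 2 ℕ.* (2 ℕ.* s ℕ.* (d ℕ.+ s))
                          ≡ (d ℕ.+ 2 ℕ.* s) ℕ.* (d ℕ.+ 2 ℕ.* s)
  complete-square = solve-∀

-- Bernoulli's inequality (k / (1 + k))^j ≥ 1 − j / (1 + k), with r = 1 + k − j.
bernoulli : ∀ k j r → j ℕ.+ r ≡ suc k → suc k ^ j ℕ.* r ℕ.≤ k ^ j ℕ.* suc k
bernoulli k zero    r refl = ℕₚ.≤-refl
bernoulli k (suc j) r j+r  = begin
  suc k ℕ.* suc k ^ j ℕ.* r      ≡⟨ swap (suc k) (suc k ^ j) r ⟩
  suc k ^ j ℕ.* (r ℕ.+ k ℕ.* r)  ≤⟨ ℕₚ.*-monoʳ-≤ (suc k ^ j) (ℕₚ.+-monoˡ-≤ (k ℕ.* r) r≤k) ⟩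
  suc k ^ j ℕ.* (k ℕ.+ k ℕ.* r)  ≡⟨ pull (suc k ^ j) k r ⟩
  k ℕ.* (suc k ^ j ℕ.* suc r)    ≤⟨ ℕₚ.*-monoʳ-≤ k (bernoulli k j (suc r) (trans (ℕₚ.+-suc j r) j+r)) ⟩
  k ℕ.* (k ^ j ℕ.* suc k)        ≡⟨ ℕₚ.*-assoc k (k ^ j) (suc k) ⟨
  k ℕ.* k ^ j ℕ.* suc k          ∎
  where
  open ℕₚ.≤-Reasoning
  r≤k : r ℕ.≤ k
  r≤k = ℕₚ.≤-trans (ℕₚ.m≤n+m r j) (ℕₚ.≤-reflexive (ℕₚ.suc-injective j+r))
  swap : ∀ a b c → a ℕ.* b ℕ.* c ≡ b ℕ.* (a ℕ.* c)
  swap = solve-∀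
  pull : ∀ a k r → a ℕ.* (k ℕ.+ k ℕ.* r) ≡ k ℕ.* (a ℕ.* (1 ℕ.+ r))
  pull = solve-∀

-- By Bernoulli, `(k / (1 + k))^w ≥ 1 - w / (1 + k) ≥ 1/2`.
suc-^≤2* : ∀ k w → 2 ℕ.* w ℕ.≤ suc k → suc k ^ w ℕ.≤ 2 ℕ.* k ^ w
suc-^≤2* k w 2w≤ = ℕₚ.*-cancelʳ-≤ _ _ (suc k) (begin
  suc k ^ w ℕ.* suc k             ≤⟨ ℕₚ.*-monoʳ-≤ (suc k ^ w) suck≤2r ⟩
  suc k ^ w ℕ.* (2 ℕ.* r)         ≡⟨ *-swapˡ (suc k ^ w) 2 r ⟩
  2 ℕ.* (suc k ^ w ℕ.* r)         ≤⟨ ℕₚ.*-monoʳ-≤ 2 (bernoulli k w r w+r≡) ⟩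
  2 ℕ.* (k ^ w ℕ.* suc k)         ≡⟨ ℕₚ.*-assoc 2 (k ^ w) (suc k) ⟨
  2 ℕ.* k ^ w ℕ.* suc k           ∎)
  where
  open ℕₚ.≤-Reasoning
  r = suc k ℕ.∸ w
  w+r≡ : w ℕ.+ r ≡ suc k
  w+r≡ = ℕₚ.m+[n∸m]≡n (ℕₚ.≤-trans (ℕₚ.m≤m+n w _) 2w≤)
  w≤r : w ℕ.≤ r
  w≤r = ℕₚ.+-cancelˡ-≤ w w r (begin
    w ℕ.+ w   ≡⟨ cong (w ℕ.+_) (ℕₚ.+-identityʳ w) ⟨
    2 ℕ.* w   ≤⟨ 2w≤ ⟩
    suc k     ≡⟨ w+r≡ ⟨
    w ℕ.+ r   ∎)
  suck≤2r : suc k ℕ.≤ 2 ℕ.* r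
  suck≤2r = begin
    suc k     ≡⟨ w+r≡ ⟨
    w ℕ.+ r   ≤⟨ ℕₚ.+-monoˡ-≤ r w≤r ⟩
    r ℕ.+ r   ≡⟨ cong (r ℕ.+_) (ℕₚ.+-identityʳ r) ⟨
    2 ℕ.* r   ∎

-- An integer substitute for `(1 + τ / 2w)^w ≤ e^(τ/2) ≤ 2^τ`: the base grows from `2w` by `τ` unit
-- steps, each costing at most a factor `2`.
[2w+τ]^w≤ : ∀ w τ → (2 ℕ.* w ℕ.+ τ) ^ w ℕ.≤ 2 ^ τ ℕ.* (2 ℕ.* w) ^ w
[2w+τ]^w≤ w zero    = ℕₚ.≤-reflexive (trans (cong (_^ w) (ℕₚ.+-identityʳ _)) (sym (ℕₚ.*-identityˡ _)))
[2w+τ]^w≤ w (suc τ) = begin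
  (2 ℕ.* w ℕ.+ suc τ) ^ w             ≡⟨ cong (_^ w) (ℕₚ.+-suc (2 ℕ.* w) τ) ⟩
  suc (2 ℕ.* w ℕ.+ τ) ^ w             ≤⟨ suc-^≤2* _ w (ℕₚ.m≤n⇒m≤1+n (ℕₚ.m≤m+n _ τ)) ⟩
  2 ℕ.* (2 ℕ.* w ℕ.+ τ) ^ w           ≤⟨ ℕₚ.*-monoʳ-≤ 2 ([2w+τ]^w≤ w τ) ⟩
  2 ℕ.* (2 ^ τ ℕ.* (2 ℕ.* w) ^ w)     ≡⟨ ℕₚ.*-assoc 2 (2 ^ τ) _ ⟨
  2 ^ suc τ ℕ.* (2 ℕ.* w) ^ w         ∎
  where open ℕₚ.≤-Reasoning

-- The starting denominator `4 · 2^N` makes `1 + 2A` equal to `1 + τ / 2w` with `w = 2^N`, and `N`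
-- squarings raise it to the power `w`.
den+2num≤ : ∀ N τ → let d = 4 ℕ.* 2 ^ N in den N τ d ℕ.+ 2 ℕ.* num N τ d ℕ.≤ 2 ^ τ ℕ.* den N τ d
den+2num≤ N τ = begin
  den N τ d ℕ.+ 2 ℕ.* num N τ d       ≡⟨ den+2num≡ N τ d ⟩
  (d ℕ.+ 2 ℕ.* τ) ^ w                 ≡⟨ cong (_^ w) (factor w τ) ⟩
  (2 ℕ.* (2 ℕ.* w ℕ.+ τ)) ^ w         ≡⟨ ^-distribʳ-* 2 _ w ⟩
  2 ^ w ℕ.* (2 ℕ.* w ℕ.+ τ) ^ w       ≤⟨ ℕₚ.*-monoʳ-≤ (2 ^ w) ([2w+τ]^w≤ w τ) ⟩
  2 ^ w ℕ.* (2 ^ τ ℕ.* (2 ℕ.* w) ^ w) ≡⟨ *-swapˡ (2 ^ w) (2 ^ τ) _ ⟩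
  2 ^ τ ℕ.* (2 ^ w ℕ.* (2 ℕ.* w) ^ w) ≡⟨ cong (2 ^ τ ℕ.*_) (^-distribʳ-* 2 (2 ℕ.* w) w) ⟨
  2 ^ τ ℕ.* (2 ℕ.* (2 ℕ.* w)) ^ w     ≡⟨ cong (λ z → 2 ^ τ ℕ.* z ^ w) (ℕₚ.*-assoc 2 2 w) ⟨
  2 ^ τ ℕ.* d ^ w                     ≡⟨ cong (2 ^ τ ℕ.*_) (den≡ N τ d) ⟨
  2 ^ τ ℕ.* den N τ d                 ∎
  where
  open ℕₚ.≤-Reasoning
  w = 2 ^ N
  d = 4 ℕ.* w
  factor : ∀ w τ → 4 ℕ.* w ℕ.+ 2 ℕ.* τ ≡ 2 ℕ.* (2 ℕ.* w ℕ.+ τ)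
  factor = solve-∀

-- With `A = s / d` the hypotheses give `n (1 + 2A) ≤ 1 + E`. The term `n ≥ 1` pays for the `1`, and
-- one of the two copies of `n A` is given away.
threshold-reached : ∀ s d n b E .{{_ : NonZero n}} → d ℕ.+ 2 ℕ.* s ℕ.≤ b ℕ.* d → n ℕ.* b ℕ.≤ suc E →
                    s ℕ.* n ℕ.≤ d ℕ.* E
threshold-reached s d n b E d+2s≤ nb≤ = ℕₚ.+-cancelˡ-≤ d _ _ (begin
  d ℕ.+ s ℕ.* n              ≤⟨ ℕₚ.+-mono-≤ (ℕₚ.m≤m*n d n) (ℕₚ.m≤m+n (s ℕ.* n) (s ℕ.* n)) ⟩
  d ℕ.* n ℕ.+ (s ℕ.* n ℕ.+ s ℕ.* n) ≡⟨ collect d s n ⟩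
  n ℕ.* (d ℕ.+ 2 ℕ.* s)      ≤⟨ ℕₚ.*-monoʳ-≤ n d+2s≤ ⟩
  n ℕ.* (b ℕ.* d)            ≡⟨ ℕₚ.*-assoc n b d ⟨
  n ℕ.* b ℕ.* d              ≤⟨ ℕₚ.*-monoˡ-≤ d nb≤ ⟩
  suc E ℕ.* d                ≡⟨ cong (d ℕ.+_) (ℕₚ.*-comm E d) ⟩
  d ℕ.+ d ℕ.* E              ∎)
  where
  open ℕₚ.≤-Reasoning
  collect : ∀ d s n → d ℕ.* n ℕ.+ (s ℕ.* n ℕ.+ s ℕ.* n) ≡ n ℕ.* (d ℕ.+ 2 ℕ.* s)
  collect = solve-∀

-- Application to a set of points

multiplicity : ∀ {u} → List (F₂^ u) → F₂^ u → ℕ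
multiplicity S x = ∑[ s ∈ S ] ⟦ s ≟V x ⟧

∑-multiplicity : ∀ {u} (S : List (F₂^ u)) (g : F₂^ u → ℕ) →
                 ∑[ x ∈ allF₂^ u ] (multiplicity S x ℕ.* g x) ≡ ∑ S g
∑-multiplicity {u} S g = begin
  ∑[ x ∈ allF₂^ u ] (multiplicity S x ℕ.* g x)
    ≡⟨ ∑-cong (allF₂^ u) (λ x → ∑-*ʳ S (g x) _) ⟨
  ∑[ x ∈ allF₂^ u ] ∑[ s ∈ S ] (⟦ s ≟V x ⟧ ℕ.* g x)
    ≡⟨ ∑-swap (allF₂^ u) S _ ⟩
  ∑[ s ∈ S ] ∑[ x ∈ allF₂^ u ] (⟦ s ≟V x ⟧ ℕ.* g x)
    ≡⟨ ∑-cong S (λ s → ∑-δ s g) ⟩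
  ∑ S g ∎
  where open ≡-Reasoning

multiplicity-∉ : ∀ {u} {S : List (F₂^ u)} {x} → All (x ≢_) S → multiplicity S x ≡ 0
multiplicity-∉ []           = refl
multiplicity-∉ (x≢s ∷ x≢S) = cong₂ ℕ._+_ (⟦⟧-false (_ ≟V _) (x≢s ∘ sym)) (multiplicity-∉ x≢S)

multiplicity≤1 : ∀ {u} {S : List (F₂^ u)} → Unique S → ∀ x → multiplicity S x ℕ.≤ 1
multiplicity≤1 []                 x = z≤n
multiplicity≤1 (_∷_ {s} s≢S uniq) x with s ≟V x
... | yes refl = s≤s (ℕₚ.≤-reflexive (multiplicity-∉ s≢S))
... | no  _    = multiplicity≤1 uniq x

load : ∀ {u ℓ} → List (F₂^ u) → F₂^ ℓ → F₂^ u → ℕ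
load S z x = ⟦ 𝟎 ≟V z ⟧ ℕ.* multiplicity S x

-- A point `s` with `h s = y` is counted at `(y + h s , s) = (0 , s)`, in the slice that carries
-- `S`.
fiberSize≤push : ∀ {u ℓ} (S : List (F₂^ u)) (h : LinMap u ℓ) y → fiberSize S h y ℕ.≤ push (load S) h y
fiberSize≤push {u} S h y = begin
  fiberSize S h y
    ≡⟨ length-filter≡∑ (λ x → apply h x ≟V y) S ⟩
  ∑[ s ∈ S ] ⟦ apply h s ≟V y ⟧
    ≤⟨ ∑-mono S (λ s → ⟦⟧-mono (apply h s ≟V y) (𝟎 ≟V (y ⊕ apply h s))
         λ hs≡y → trans (sym (⊕-self y)) (cong (y ⊕_) (sym hs≡y))) ⟩
  ∑[ s ∈ S ] ⟦ 𝟎 ≟V (y ⊕ apply h s) ⟧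
    ≡⟨ ∑-multiplicity S _ ⟨
  ∑[ x ∈ allF₂^ u ] (multiplicity S x ℕ.* ⟦ 𝟎 ≟V (y ⊕ apply h x) ⟧)
    ≡⟨ ∑-cong (allF₂^ u) (λ x → ℕₚ.*-comm (multiplicity S x) _) ⟩
  push (load S) h y ∎
  where open ℕₚ.≤-Reasoning

-- A positive `k` excludes the default `0` of the fold, so the maximum comes from an actual element.
≤-maximum⁻ : ∀ (f : A → ℕ) (xs : List A) {k} .{{_ : NonZero k}} →
             k ℕ.≤ foldr _⊔_ 0 (map f xs) → ∃ λ x → x ∈ xs × k ℕ.≤ f x
≤-maximum⁻ f []       {suc k} ()
≤-maximum⁻ f (x ∷ xs) {k} k≤ with ℕₚ.⊔-sel (f x) (foldr _⊔_ 0 (map f xs))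
... | inj₁ eq = x , here refl , subst (k ℕ.≤_) eq k≤
... | inj₂ eq with ≤-maximum⁻ f xs (subst (k ℕ.≤_) eq k≤)
...   | y , y∈ , k≤fy = y , there y∈ , k≤fy

-- The weight `a^k - 1` vanishes at `k = 0`, so empty cells carry no energy; for nonzero `a` the
-- `pred` is a true subtraction.
excess : ℕ → ℕ → ℕ
excess a k = pred (a ^ k)

suc-excess : ∀ a .{{_ : NonZero a}} k → suc (excess a k) ≡ a ^ k
suc-excess a k = ℕₚ.suc-pred (a ^ k) {{m^n≢0 a k}}

excess-+ : ∀ a .{{_ : NonZero a}} i j →
           excess a (i ℕ.+ j) ≡ excess a i ℕ.+ excess a j ℕ.+ excess a i ℕ.* excess a j
excess-+ a i j = ℕₚ.suc-injective (begin
  suc (excess a (i ℕ.+ j))                  ≡⟨ suc-excess a (i ℕ.+ j) ⟩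
  a ^ (i ℕ.+ j)                             ≡⟨ ℕₚ.^-distribˡ-+-* a i j ⟩
  a ^ i ℕ.* a ^ j                           ≡⟨ cong₂ ℕ._*_ (suc-excess a i) (suc-excess a j) ⟨
  suc (excess a i) ℕ.* suc (excess a j)     ≡⟨ expand (excess a i) (excess a j) ⟩
  suc (excess a i ℕ.+ excess a j ℕ.+ excess a i ℕ.* excess a j) ∎)
  where
  open ≡-Reasoning
  expand : ∀ x y → (1 ℕ.+ x) ℕ.* (1 ℕ.+ y) ≡ 1 ℕ.+ (x ℕ.+ y ℕ.+ x ℕ.* y)
  expand = solve-∀

excess≤* : ∀ a {k} → k ℕ.≤ 1 → excess a k ℕ.≤ k ℕ.* a
excess≤* a {zero}  _ = z≤n
excess≤* a {suc zero} _ = begin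
  pred (a ℕ.* 1)  ≤⟨ ℕₚ.pred[n]≤n ⟩
  a ℕ.* 1         ≡⟨ ℕₚ.*-comm a 1 ⟩
  1 ℕ.* a         ∎
  where open ℕₚ.≤-Reasoning
excess≤* a {suc (suc k)} (s≤s ())

-- Distinctness makes every initial load `0` or `1`, where `a^k - 1 ≤ k a`; hence each point of `S`
-- costs at most `a`.
energy-load≤ : ∀ {u} ℓ a .{{_ : NonZero a}} {S : List (F₂^ u)} → Unique S →
               Process.energy (excess a) (excess-+ a) (load {ℓ = ℓ} S) ℕ.≤ length S ℕ.* a
energy-load≤ {u} ℓ a {S} uniq = begin
  ∑[ z ∈ allF₂^ ℓ ] ∑[ x ∈ allF₂^ u ] excess a (load S z x)
    ≤⟨ ∑₂-mono {ℓ} {u} (λ z x → excess≤* a (ℕₚ.*-mono-≤ (⟦⟧≤1 (𝟎 ≟V z)) (multiplicity≤1 uniq x))) ⟩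
  ∑[ z ∈ allF₂^ ℓ ] ∑[ x ∈ allF₂^ u ] (load S z x ℕ.* a)
    ≡⟨ ∑-cong (allF₂^ ℓ) (λ z → trans
         (∑-cong (allF₂^ u) λ x → ℕₚ.*-assoc ⟦ 𝟎 ≟V z ⟧ (multiplicity S x) a)
         (∑-*ˡ (allF₂^ u) ⟦ 𝟎 ≟V z ⟧ λ x → multiplicity S x ℕ.* a)) ⟩
  ∑[ z ∈ allF₂^ ℓ ] (⟦ 𝟎 ≟V z ⟧ ℕ.* ∑[ x ∈ allF₂^ u ] (multiplicity S x ℕ.* a))
    ≡⟨ ∑-δ {ℓ} 𝟎 (λ _ → ∑[ x ∈ allF₂^ u ] (multiplicity S x ℕ.* a)) ⟩
  ∑[ x ∈ allF₂^ u ] (multiplicity S x ℕ.* a)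
    ≡⟨ ∑-multiplicity S (λ _ → a) ⟩
  ∑[ _ ∈ S ] a
    ≡⟨ ∑-const S a ⟩
  length S ℕ.* a ∎
  where open ℕₚ.≤-Reasoning

-- With `a = 2^(1+t)`, `A = τ / 4w` and `ε ≤ m a / (n w)`, the ratio `ε / A` is at most
-- `8 m 2^t / (τ n)`. The domain size `w` cancels, which is why both sides are first multiplied by
-- `w²`.
count-max-load : ∀ u ℓ (S : List (F₂^ u)) → Unique S → ∀ t τ .{{_ : NonZero τ}} → ℓ ℕ.≤ t ℕ.* τ →
  ∑[ h ∈ allLinMaps u ℓ ] ⟦ τ ℕₚ.≤? M S h ⟧ ℕ.* sq (τ ℕ.* 2 ^ ℓ)
    ℕ.≤ 2 ^ (ℓ ℕ.* u) ℕ.* sq (8 ℕ.* length S ℕ.* 2 ^ t)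
count-max-load u ℓ S uniq t τ ℓ≤tτ = ℕₚ.*-cancelˡ-≤ (sq w) {{ℕₚ.m*n≢0 w w}} (begin
  sq w ℕ.* (∑[ h ∈ allLinMaps u ℓ ] ⟦ τ ℕₚ.≤? M S h ⟧ ℕ.* sq (τ ℕ.* n))
    ≤⟨ ℕₚ.*-monoʳ-≤ (sq w) (ℕₚ.*-monoˡ-≤ (sq (τ ℕ.* n)) (∑-mono (allLinMaps u ℓ) λ h →
         ⟦⟧-mono (τ ℕₚ.≤? M S h) (num u τ d ℕ.* n ℕₚ.≤? den u τ d ℕ.* outcome f h)
                 (overload h))) ⟩
  sq w ℕ.* (count ι ι≤1 f ℕ.* sq (τ ℕ.* n))
    ≡⟨ regroup w (count ι ι≤1 f) τ n ⟩
  count ι ι≤1 f ℕ.* sq (τ ℕ.* (n ℕ.* w))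
    ≤⟨ tail-bound ι ι≤1 u τ d {{ℕₚ.m*n≢0 4 w}} ι-bound f ⟩
  K ℕ.* sq (d ℕ.* energy f)
    ≤⟨ ℕₚ.*-monoʳ-≤ K (ℕₚ.*-mono-≤ energy≤ energy≤) ⟩
  K ℕ.* sq (d ℕ.* (m ℕ.* a))
    ≡⟨ regroup′ K w m (2 ^ t) ⟩
  sq w ℕ.* (K ℕ.* sq (8 ℕ.* m ℕ.* 2 ^ t)) ∎)
  where
  n w d m a K : ℕ
  n = 2 ^ ℓ
  w = 2 ^ u
  d = 4 ℕ.* w
  m = length S
  a = 2 ^ suc t
  K = 2 ^ (ℓ ℕ.* u)
  instance
    n≢0 : NonZero n
    n≢0 = m^n≢0 2 ℓ
    w≢0 : NonZero w
    w≢0 = m^n≢0 2 u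
    a≢0 : NonZero a
    a≢0 = m^n≢0 2 (suc t)
  open Process (excess a) (excess-+ a)
  open ℕₚ.≤-Reasoning

  f : F₂^ ℓ → F₂^ u → ℕ
  f = load S

  ι : ℕ → ℕ
  ι E = ⟦ num u τ d ℕ.* n ℕₚ.≤? den u τ d ℕ.* E ⟧
  ι≤1 : ∀ E → ι E ℕ.≤ 1
  ι≤1 E = ⟦⟧≤1 (num u τ d ℕ.* n ℕₚ.≤? den u τ d ℕ.* E)
  ι-bound : ∀ E → ι E ℕ.* sq (num u τ d ℕ.* n) ℕ.≤ sq (den u τ d ℕ.* E)
  ι-bound E with num u τ d ℕ.* n ℕₚ.≤? den u τ d ℕ.* E
  ... | yes le = ℕₚ.≤-trans (ℕₚ.≤-reflexive (ℕₚ.*-identityˡ _)) (ℕₚ.*-mono-≤ le le)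
  ... | no  _  = z≤n

  -- One cell suffices: `n ≤ 2^(t τ)`, so a load of `τ` already gives `a^τ ≥ n 2^τ`, and `2^τ`
  -- dominates `1 + 2A` at the final threshold.
  overload : ∀ h → τ ℕ.≤ M S h → num u τ d ℕ.* n ℕ.≤ den u τ d ℕ.* outcome f h
  overload h τ≤M with ≤-maximum⁻ (fiberSize S h) (allF₂^ ℓ) τ≤M
  ... | y , y∈ , τ≤fiber = threshold-reached (num u τ d) (den u τ d) n (2 ^ τ) _ (den+2num≤ u τ) (begin
    n ℕ.* 2 ^ τ                            ≤⟨ ℕₚ.*-monoˡ-≤ (2 ^ τ) (ℕₚ.^-monoʳ-≤ 2 ℓ≤tτ) ⟩
    2 ^ (t ℕ.* τ) ℕ.* 2 ^ τ                ≡⟨ ℕₚ.^-distribˡ-+-* 2 (t ℕ.* τ) τ ⟨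
    2 ^ (t ℕ.* τ ℕ.+ τ)                    ≡⟨ cong (2 ^_) (ℕₚ.+-comm (t ℕ.* τ) τ) ⟩
    2 ^ (suc t ℕ.* τ)                      ≡⟨ ℕₚ.^-*-assoc 2 (suc t) τ ⟨
    a ^ τ                                  ≤⟨ ℕₚ.^-monoʳ-≤ a (ℕₚ.≤-trans τ≤fiber (fiberSize≤push S h y)) ⟩
    a ^ push f h y                  ≡⟨ suc-excess a (push f h y) ⟨
    suc (excess a (push f h y))     ≤⟨ s≤s (∑-∈-≤ (λ y → excess a (push f h y)) y∈) ⟩
    suc (outcome f h)               ∎)

  energy≤ : d ℕ.* energy f ℕ.≤ d ℕ.* (m ℕ.* a)
  energy≤ = ℕₚ.*-monoʳ-≤ d (energy-load≤ ℓ a uniq)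

  regroup : ∀ w c τ n → w ℕ.* w ℕ.* (c ℕ.* (τ ℕ.* n ℕ.* (τ ℕ.* n)))
                      ≡ c ℕ.* (τ ℕ.* (n ℕ.* w) ℕ.* (τ ℕ.* (n ℕ.* w)))
  regroup = solve-∀
  regroup′ : ∀ k w m x →
    k ℕ.* (4 ℕ.* w ℕ.* (m ℕ.* (2 ℕ.* x)) ℕ.* (4 ℕ.* w ℕ.* (m ℕ.* (2 ℕ.* x))))
    ≡ w ℕ.* w ℕ.* (k ℕ.* (8 ℕ.* m ℕ.* x ℕ.* (8 ℕ.* m ℕ.* x)))
  regroup′ = solve-∀

-- Nonnegative fractions

-- Since `_/_` reduces to lowest terms, products and comparisons are computed on unnormalised
-- fractions, where they are plain cross-multiplication.
toℚᵘ-/ : ∀ a b → ℚ.toℚᵘ (+ a / suc b) ℚᵘ.≃ ℚᵘ.mkℚᵘ (+ a) b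
toℚᵘ-/ a b = ℚₚ.toℚᵘ-fromℚᵘ (ℚᵘ.mkℚᵘ (+ a) b)

/-* : ∀ a b c d .{{_ : NonZero b}} .{{_ : NonZero d}} →
      (+ a / b) * (+ c / d) ≡ _/_ (+ (a ℕ.* c)) (b ℕ.* d) {{ℕₚ.m*n≢0 b d}}
/-* a b@(suc b′) c d@(suc d′) = ℚₚ.toℚᵘ-injective (begin
  ℚ.toℚᵘ ((+ a / b) * (+ c / d))              ≈⟨ ℚₚ.toℚᵘ-homo-* (+ a / b) (+ c / d) ⟩
  ℚ.toℚᵘ (+ a / b) ℚᵘ.* ℚ.toℚᵘ (+ c / d)      ≈⟨ ℚᵘₚ.*-cong (toℚᵘ-/ a b′) (toℚᵘ-/ c d′) ⟩
  ℚᵘ.mkℚᵘ (+ a ℤ.* + c) (pred (b ℕ.* d))      ≡⟨ cong (λ z → ℚᵘ.mkℚᵘ z (pred (b ℕ.* d))) (ℤₚ.pos-* a c) ⟨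
  ℚᵘ.mkℚᵘ (+ (a ℕ.* c)) (pred (b ℕ.* d))      ≈⟨ toℚᵘ-/ (a ℕ.* c) (pred (b ℕ.* d)) ⟨
  ℚ.toℚᵘ (+ (a ℕ.* c) / (b ℕ.* d))            ∎)
  where open import Relation.Binary.Reasoning.Setoid ℚᵘₚ.≃-setoid

/-^ : ∀ a b k .{{_ : NonZero b}} → (+ a / b) ^ℚ k ≡ _/_ (+ (a ^ k)) (b ^ k) {{m^n≢0 b k}}
/-^ a b zero    = refl
/-^ a b (suc k) = trans (cong ((+ a / b) *_) (/-^ a b k)) (/-* a b (a ^ k) (b ^ k))
  where instance
    b^k≢0 : NonZero (b ^ k)
    b^k≢0 = m^n≢0 b k

/-≤⁺ : ∀ a b c d .{{_ : NonZero b}} .{{_ : NonZero d}} → a ℕ.* d ℕ.≤ c ℕ.* b → + a / b ≤ + c / d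
/-≤⁺ a b@(suc b′) c d@(suc d′) ad≤cb = ℚₚ.toℚᵘ-cancel-≤
  (ℚᵘₚ.≤-respˡ-≃ (ℚᵘₚ.≃-sym (toℚᵘ-/ a b′)) (ℚᵘₚ.≤-respʳ-≃ (ℚᵘₚ.≃-sym (toℚᵘ-/ c d′))
    (ℚᵘ.*≤* (subst₂ ℤ._≤_ (ℤₚ.pos-* a d) (ℤₚ.pos-* c b) (ℤ.+≤+ ad≤cb)))))

/-≤⁻ : ∀ a b c d .{{_ : NonZero b}} .{{_ : NonZero d}} → + a / b ≤ + c / d → a ℕ.* d ℕ.≤ c ℕ.* b
/-≤⁻ a b@(suc b′) c d@(suc d′) a/b≤c/d = ℤₚ.drop‿+≤+ (subst₂ ℤ._≤_ (sym (ℤₚ.pos-* a d)) (sym (ℤₚ.pos-* c b))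
  (ℚᵘₚ.drop-*≤* (ℚᵘₚ.≤-respˡ-≃ (toℚᵘ-/ a b′) (ℚᵘₚ.≤-respʳ-≃ (toℚᵘ-/ c d′) (ℚₚ.toℚᵘ-mono-≤ a/b≤c/d)))))

-- Rational thresholds and fractional powers

-- The maximum load is an integer, so it reaches `p / q` only by reaching the ceiling `τ`; `p ≤ τ q`
-- then carries the bound for `τ` back to `p / q`.
count-rational-load : ∀ u ℓ (S : List (F₂^ u)) → Unique S →
  ∀ p q t .{{_ : NonZero p}} .{{_ : NonZero q}} → ℓ ℕ.* q ℕ.≤ t ℕ.* p →
  length (filter (λ h → + p / q ℚ.≤? ℕ→ℚ (M S h)) (allLinMaps u ℓ)) ℕ.* sq (p ℕ.* 2 ^ ℓ)
    ℕ.≤ 2 ^ (ℓ ℕ.* u) ℕ.* sq (q ℕ.* (8 ℕ.* length S ℕ.* 2 ^ t))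
count-rational-load u ℓ S uniq p q t ℓq≤tp = begin
  length (filter (λ h → + p / q ℚ.≤? ℕ→ℚ (M S h)) H) ℕ.* sq (p ℕ.* 2 ^ ℓ)
    ≡⟨ cong (ℕ._* sq (p ℕ.* 2 ^ ℓ)) (length-filter≡∑ (λ h → + p / q ℚ.≤? ℕ→ℚ (M S h)) H) ⟩
  ∑[ h ∈ H ] ⟦ + p / q ℚ.≤? ℕ→ℚ (M S h) ⟧ ℕ.* sq (p ℕ.* 2 ^ ℓ)
    ≤⟨ ℕₚ.*-mono-≤
         (∑-mono H λ h → ⟦⟧-mono (+ p / q ℚ.≤? ℕ→ℚ (M S h)) (τ ℕₚ.≤? M S h) (τ≤ (M S h)))
         (ℕₚ.*-mono-≤ pn≤ pn≤) ⟩
  ∑[ h ∈ H ] ⟦ τ ℕₚ.≤? M S h ⟧ ℕ.* sq (τ ℕ.* q ℕ.* 2 ^ ℓ)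
    ≡⟨ regroup (∑[ h ∈ H ] ⟦ τ ℕₚ.≤? M S h ⟧) τ q (2 ^ ℓ) ⟩
  sq q ℕ.* (∑[ h ∈ H ] ⟦ τ ℕₚ.≤? M S h ⟧ ℕ.* sq (τ ℕ.* 2 ^ ℓ))
    ≤⟨ ℕₚ.*-monoʳ-≤ (sq q) (count-max-load u ℓ S uniq t τ ℓ≤tτ) ⟩
  sq q ℕ.* (2 ^ (ℓ ℕ.* u) ℕ.* sq (8 ℕ.* length S ℕ.* 2 ^ t))
    ≡⟨ regroup′ (2 ^ (ℓ ℕ.* u)) q (8 ℕ.* length S ℕ.* 2 ^ t) ⟩
  2 ^ (ℓ ℕ.* u) ℕ.* sq (q ℕ.* (8 ℕ.* length S ℕ.* 2 ^ t)) ∎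
  where
  open ℕₚ.≤-Reasoning
  H = allLinMaps u ℓ
  -- ⌈ p / q ⌉
  τ = suc (pred p ℕ./ q)
  p≤τq : p ℕ.≤ τ ℕ.* q
  p≤τq = begin
    p                                       ≡⟨ ℕₚ.suc-pred p ⟨
    suc (pred p)                            ≡⟨ cong suc (m≡m%n+[m/n]*n (pred p) q) ⟩
    suc (pred p ℕ.% q) ℕ.+ pred p ℕ./ q ℕ.* q ≤⟨ ℕₚ.+-monoˡ-≤ _ (m%n<n (pred p) q) ⟩
    τ ℕ.* q                                 ∎
  pn≤ : p ℕ.* 2 ^ ℓ ℕ.≤ τ ℕ.* q ℕ.* 2 ^ ℓ
  pn≤ = ℕₚ.*-monoˡ-≤ (2 ^ ℓ) p≤τq
  τ≤ : ∀ k → + p / q ≤ ℕ→ℚ k → τ ℕ.≤ k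
  τ≤ k p/q≤k = m<n*o⇒m/o<n (begin
    suc (pred p)   ≡⟨ ℕₚ.suc-pred p ⟩
    p              ≡⟨ ℕₚ.*-identityʳ p ⟨
    p ℕ.* 1        ≤⟨ /-≤⁻ p q k 1 p/q≤k ⟩
    k ℕ.* q        ∎)
  ℓ≤tτ : ℓ ℕ.≤ t ℕ.* τ
  ℓ≤tτ = ℕₚ.*-cancelʳ-≤ ℓ (t ℕ.* τ) q (begin
    ℓ ℕ.* q          ≤⟨ ℓq≤tp ⟩
    t ℕ.* p          ≤⟨ ℕₚ.*-monoʳ-≤ t p≤τq ⟩
    t ℕ.* (τ ℕ.* q)  ≡⟨ ℕₚ.*-assoc t τ q ⟨
    t ℕ.* τ ℕ.* q    ∎)
  regroup : ∀ c τ q n → c ℕ.* (τ ℕ.* q ℕ.* n ℕ.* (τ ℕ.* q ℕ.* n)) ≡ q ℕ.* q ℕ.* (c ℕ.* (τ ℕ.* n ℕ.* (τ ℕ.* n)))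
  regroup = solve-∀
  regroup′ : ∀ k q x → q ℕ.* q ℕ.* (k ℕ.* (x ℕ.* x)) ≡ k ℕ.* (q ℕ.* x ℕ.* (q ℕ.* x))
  regroup′ = solve-∀

-- Here `t` stands for the power of two chosen as `2^t`, and `x` for `n^q`. That power is compared
-- with `n^(q/p)` only through `p`-th powers, so the whole bound is raised to the power `p`. The
-- constant is `256 = 8² · 2²`: the `8` of the counting bound and the `2` lost in rounding.
raise-bound : ∀ c K m n p q t x → t ^ p ℕ.≤ 2 ^ p ℕ.* x →
  c ℕ.* sq (p ℕ.* n) ℕ.≤ K ℕ.* sq (q ℕ.* (8 ℕ.* m ℕ.* t)) →
  (c ℕ.* (p ℕ.* p)) ^ p ℕ.* (n ℕ.* n) ^ p ℕ.≤ (256 ℕ.* (m ℕ.* m)) ^ p ℕ.* sq x ℕ.* (K ℕ.* (q ℕ.* q)) ^ p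
raise-bound c K m n p q t x t^p≤ bound = begin
  (c ℕ.* (p ℕ.* p)) ^ p ℕ.* (n ℕ.* n) ^ p
    ≡⟨ ^-distribʳ-* (c ℕ.* (p ℕ.* p)) (n ℕ.* n) p ⟨
  (c ℕ.* (p ℕ.* p) ℕ.* (n ℕ.* n)) ^ p
    ≡⟨ cong (_^ p) (lhs c p n) ⟩
  (c ℕ.* sq (p ℕ.* n)) ^ p
    ≤⟨ ℕₚ.^-monoˡ-≤ p bound ⟩
  (K ℕ.* sq (q ℕ.* (8 ℕ.* m ℕ.* t))) ^ p
    ≡⟨ cong (_^ p) (rhs K q m t) ⟩
  (y ℕ.* (t ℕ.* t)) ^ p
    ≡⟨ trans (^-distribʳ-* y (t ℕ.* t) p) (cong (y ^ p ℕ.*_) (^-distribʳ-* t t p)) ⟩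
  y ^ p ℕ.* sq (t ^ p)
    ≤⟨ ℕₚ.*-monoʳ-≤ (y ^ p) (ℕₚ.*-mono-≤ t^p≤ t^p≤) ⟩
  y ^ p ℕ.* sq (2 ^ p ℕ.* x)
    ≡⟨ regroup (y ^ p) (2 ^ p) x ⟩
  y ^ p ℕ.* (2 ^ p ℕ.* 2 ^ p) ℕ.* sq x
    ≡⟨ cong (λ z → y ^ p ℕ.* z ℕ.* sq x) (^-distribʳ-* 2 2 p) ⟨
  y ^ p ℕ.* 4 ^ p ℕ.* sq x
    ≡⟨ cong (ℕ._* sq x) (^-distribʳ-* y 4 p) ⟨
  (y ℕ.* 4) ^ p ℕ.* sq x
    ≡⟨ cong (λ z → z ^ p ℕ.* sq x) (constant K q m) ⟩
  (256 ℕ.* (m ℕ.* m) ℕ.* (K ℕ.* (q ℕ.* q))) ^ p ℕ.* sq x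
    ≡⟨ cong (ℕ._* sq x) (^-distribʳ-* (256 ℕ.* (m ℕ.* m)) (K ℕ.* (q ℕ.* q)) p) ⟩
  (256 ℕ.* (m ℕ.* m)) ^ p ℕ.* (K ℕ.* (q ℕ.* q)) ^ p ℕ.* sq x
    ≡⟨ swap ((256 ℕ.* (m ℕ.* m)) ^ p) ((K ℕ.* (q ℕ.* q)) ^ p) (sq x) ⟩
  (256 ℕ.* (m ℕ.* m)) ^ p ℕ.* sq x ℕ.* (K ℕ.* (q ℕ.* q)) ^ p ∎
  where
  open ℕₚ.≤-Reasoning
  y = K ℕ.* (q ℕ.* q) ℕ.* (64 ℕ.* (m ℕ.* m))
  lhs : ∀ c p n → c ℕ.* (p ℕ.* p) ℕ.* (n ℕ.* n) ≡ c ℕ.* (p ℕ.* n ℕ.* (p ℕ.* n))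
  lhs = solve-∀
  rhs : ∀ K q m t → K ℕ.* (q ℕ.* (8 ℕ.* m ℕ.* t) ℕ.* (q ℕ.* (8 ℕ.* m ℕ.* t)))
                  ≡ K ℕ.* (q ℕ.* q) ℕ.* (64 ℕ.* (m ℕ.* m)) ℕ.* (t ℕ.* t)
  rhs = solve-∀
  regroup : ∀ y a x → y ℕ.* (a ℕ.* x ℕ.* (a ℕ.* x)) ≡ y ℕ.* (a ℕ.* a) ℕ.* (x ℕ.* x)
  regroup = solve-∀
  constant : ∀ K q m → K ℕ.* (q ℕ.* q) ℕ.* (64 ℕ.* (m ℕ.* m)) ℕ.* 4
                     ≡ 256 ℕ.* (m ℕ.* m) ℕ.* (K ℕ.* (q ℕ.* q))
  constant = solve-∀
  swap : ∀ a b c → a ℕ.* b ℕ.* c ≡ a ℕ.* c ℕ.* b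
  swap = solve-∀

-- In general `n^(1/T) = n^(q/p)` is irrational. The `p`-th power of `Pr · T² ≤ 256 λ² n^(2/T)`
-- involves rationals only, and is equivalent because both sides are nonnegative.
tail-probability-bound : ∀ u ℓ (S : List (F₂^ u)) → Unique S →
  let n  = 2 ^ ℓ
      λ' = _/_ (+ length S) n {{m^n≢0 2 ℓ}}
  in ∀ p q .{{_ : NonZero p}} .{{_ : NonZero q}} →
    let T = + p / q
    in (PrMge u ℓ S T * (T * T)) ^ℚ p ≤ ((ℕ→ℚ 256 * (λ' * λ')) ^ℚ p) * (ℕ→ℚ n ^ℚ (2 ℕ.* q))
tail-probability-bound u ℓ S uniq p q = subst₂ _≤_ (sym lhs) (sym rhs)
  -- The factors `1` and `1 ^ (2 ℕ.* q)` come from the denominators of `256` and `n` viewed as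
  -- fractions.
  (/-≤⁺ ((c ℕ.* (p ℕ.* p)) ^ p) ((K ℕ.* (q ℕ.* q)) ^ p)
        ((256 ℕ.* (m ℕ.* m)) ^ p ℕ.* n ^ (2 ℕ.* q)) ((1 ℕ.* (n ℕ.* n)) ^ p ℕ.* 1 ^ (2 ℕ.* q))
    (begin
      (c ℕ.* (p ℕ.* p)) ^ p ℕ.* ((1 ℕ.* (n ℕ.* n)) ^ p ℕ.* 1 ^ (2 ℕ.* q))
        ≡⟨ cong ((c ℕ.* (p ℕ.* p)) ^ p ℕ.*_) (trans
             (cong₂ ℕ._*_ (cong (_^ p) (ℕₚ.*-identityˡ (n ℕ.* n))) (ℕₚ.^-zeroˡ (2 ℕ.* q)))
             (ℕₚ.*-identityʳ _)) ⟩
      (c ℕ.* (p ℕ.* p)) ^ p ℕ.* (n ℕ.* n) ^ p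
        ≤⟨ raise-bound c K m n p q (2 ^ t) (n ^ q) 2^tp≤
             (count-rational-load u ℓ S uniq p q t ℓq≤tp) ⟩
      (256 ℕ.* (m ℕ.* m)) ^ p ℕ.* sq (n ^ q) ℕ.* (K ℕ.* (q ℕ.* q)) ^ p
        ≡⟨ cong (λ z → (256 ℕ.* (m ℕ.* m)) ^ p ℕ.* z ℕ.* (K ℕ.* (q ℕ.* q)) ^ p) (trans
             (sym (ℕₚ.^-distribˡ-+-* n q q)) (cong (λ z → n ^ (q ℕ.+ z)) (sym (ℕₚ.+-identityʳ q)))) ⟩
      (256 ℕ.* (m ℕ.* m)) ^ p ℕ.* n ^ (2 ℕ.* q) ℕ.* (K ℕ.* (q ℕ.* q)) ^ p ∎))
  where
  open ℕₚ.≤-Reasoning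
  n m K c t : ℕ
  n = 2 ^ ℓ
  m = length S
  K = 2 ^ (ℓ ℕ.* u)
  c = length (filter (λ h → + p / q ℚ.≤? ℕ→ℚ (M S h)) (allLinMaps u ℓ))
  -- Floor plus one gives `n^(q/p) ≤ 2^t ≤ 2 n^(q/p)`: the successor secures the first inequality
  -- and costs the factor `2` in the second.
  t = suc ((ℓ ℕ.* q) ℕ./ p)
  instance
    n≢0 : NonZero n
    n≢0 = m^n≢0 2 ℓ
    K≢0 : NonZero K
    K≢0 = m^n≢0 2 (ℓ ℕ.* u)
    qq≢0 : NonZero (q ℕ.* q)
    qq≢0 = ℕₚ.m*n≢0 q q
    nn≢0 : NonZero (n ℕ.* n)
    nn≢0 = ℕₚ.m*n≢0 n n
    Kqq≢0 : NonZero (K ℕ.* (q ℕ.* q))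
    Kqq≢0 = ℕₚ.m*n≢0 K (q ℕ.* q)
    1nn≢0 : NonZero (1 ℕ.* (n ℕ.* n))
    1nn≢0 = ℕₚ.m*n≢0 1 (n ℕ.* n)
    lden≢0 : NonZero ((K ℕ.* (q ℕ.* q)) ^ p)
    lden≢0 = m^n≢0 _ p
    rden₁≢0 : NonZero ((1 ℕ.* (n ℕ.* n)) ^ p)
    rden₁≢0 = m^n≢0 _ p
    rden₂≢0 : NonZero (1 ^ (2 ℕ.* q))
    rden₂≢0 = m^n≢0 1 (2 ℕ.* q)
    rden≢0 : NonZero ((1 ℕ.* (n ℕ.* n)) ^ p ℕ.* 1 ^ (2 ℕ.* q))
    rden≢0 = ℕₚ.m*n≢0 ((1 ℕ.* (n ℕ.* n)) ^ p) (1 ^ (2 ℕ.* q))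

  lhs : ((+ c / K) * ((+ p / q) * (+ p / q))) ^ℚ p ≡ + ((c ℕ.* (p ℕ.* p)) ^ p) / (K ℕ.* (q ℕ.* q)) ^ p
  lhs = trans (cong (_^ℚ p) (trans (cong ((+ c / K) *_) (/-* p q p q)) (/-* c K (p ℕ.* p) (q ℕ.* q))))
              (/-^ (c ℕ.* (p ℕ.* p)) (K ℕ.* (q ℕ.* q)) p)

  rhs : ((ℕ→ℚ 256 * ((+ m / n) * (+ m / n))) ^ℚ p) * (ℕ→ℚ n ^ℚ (2 ℕ.* q))
      ≡ + ((256 ℕ.* (m ℕ.* m)) ^ p ℕ.* n ^ (2 ℕ.* q)) / ((1 ℕ.* (n ℕ.* n)) ^ p ℕ.* 1 ^ (2 ℕ.* q))
  rhs = trans (cong₂ _*_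
    (trans (cong (_^ℚ p) (trans (cong (ℕ→ℚ 256 *_) (/-* m n m n)) (/-* 256 1 (m ℕ.* m) (n ℕ.* n))))
           (/-^ (256 ℕ.* (m ℕ.* m)) (1 ℕ.* (n ℕ.* n)) p))
    (/-^ n 1 (2 ℕ.* q)))
    (/-* ((256 ℕ.* (m ℕ.* m)) ^ p) ((1 ℕ.* (n ℕ.* n)) ^ p) (n ^ (2 ℕ.* q)) (1 ^ (2 ℕ.* q)))

  ℓq≤tp : ℓ ℕ.* q ℕ.≤ t ℕ.* p
  ℓq≤tp = begin
    ℓ ℕ.* q                                             ≡⟨ m≡m%n+[m/n]*n (ℓ ℕ.* q) p ⟩
    (ℓ ℕ.* q) ℕ.% p ℕ.+ (ℓ ℕ.* q) ℕ./ p ℕ.* p           ≤⟨ ℕₚ.+-monoˡ-≤ _ (m%n≤n (ℓ ℕ.* q) p) ⟩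
    t ℕ.* p                                             ∎

  2^tp≤ : (2 ^ t) ^ p ℕ.≤ 2 ^ p ℕ.* n ^ q
  2^tp≤ = begin
    (2 ^ t) ^ p             ≡⟨ ℕₚ.^-*-assoc 2 t p ⟩
    2 ^ (t ℕ.* p)           ≤⟨ ℕₚ.^-monoʳ-≤ 2 (ℕₚ.+-monoʳ-≤ p (m/n*n≤m (ℓ ℕ.* q) p)) ⟩
    2 ^ (p ℕ.+ ℓ ℕ.* q)     ≡⟨ ℕₚ.^-distribˡ-+-* 2 p (ℓ ℕ.* q) ⟩
    2 ^ p ℕ.* 2 ^ (ℓ ℕ.* q) ≡⟨ cong (2 ^ p ℕ.*_) (ℕₚ.^-*-assoc 2 ℓ q) ⟨
    2 ^ p ℕ.* n ^ q         ∎

theoremC2 :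
  Σ ℚ λ C → Σ ℚ λ D → (0ℚ < C) × (0ℚ < D) ×
    ((u ℓ : ℕ) (S : List (F₂^ u)) → Unique S →
      let n  = 2 ^ ℓ
          m  = length S
          λ' = _/_ (+ m) n {{m^n≢0 2 ℓ}}
      in (p q : ℕ) .{{_ : NonZero p}} .{{_ : NonZero q}} →
        let T = (+ p) / q
        in ((D * λ') ^ℚ p) * (ℕ→ℚ n ^ℚ q) ≤ T ^ℚ p →
           (PrMge u ℓ S T * (T * T)) ^ℚ p ≤ ((C * (λ' * λ')) ^ℚ p) * (ℕ→ℚ n ^ℚ (2 ℕ.* q)))
theoremC2 =
  ℕ→ℚ 256 , ℕ→ℚ 1 , ℚ.*<* (ℤ.+<+ (s≤s z≤n)) , ℚ.*<* (ℤ.+<+ (s≤s z≤n)) ,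
  λ u ℓ S uniq p q _ → tail-probability-bound u ℓ S uniq p q
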